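{- Let $p\geq 2$ and let $G$ be a finite simple $\{pK_2, \mathrm{butterfly}\}$-free graph. Then $\chi(G)\leq f_p(\omega(G))$, where $f_p:\mathbb{N}\to\mathbb{N}$ ($p\geq2$) is defined by: $f_t(1)=1$ for $t\geq2$; $f_2(2)=3$; $f_2(3)=4$; $f_2(s)=\binom{s+1}{2}$ for $s\geq 4$; $f_p(2)=2p-2$ for $p\geq 3$; and $f_p(m)=f_{p-1}(m)+\binom{m+1}{2}-1$ for $m,p\geq 3$.
   Context: $\chi(G)$ is the chromatic number and $\omega(G)$ the clique number of $G$. $pK_2$ is the disjoint union of $p$ edges. The butterfly is the graph on five vertices consisting of two triangles sharing exactly one vertex. A graph is $\mathcal{F}$-free if it has no induced subgraph isomorphic to a member of $\mathcal{F}$. -}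

module Defs where

open import Data.Nat using (ℕ; zero; suc; _+_; _*_; _∸_; _≤_; _≡ᵇ_)
open import Data.Nat.Combinatorics using (_C_)
open import Data.Fin using (Fin; toℕ; zero; suc)
open import Data.Bool using (Bool; true; false; _∨_)
open import Data.Bool.Properties using (∨-comm)
open import Data.Empty using (⊥)
open import Data.Product using (Σ; _×_; _,_)
open import Relation.Binary.PropositionalEquality using (_≡_; refl)
open import Function.Definitions using (Injective)

record Graph (n : ℕ) : Set where
  field
    adj    : Fin n → Fin n → Bool
    sym    : ∀ i j → adj i j ≡ adj j i
    irrefl : ∀ i → adj i i ≡ false
open Graph public

Adj : ∀ {n} → Graph n → Fin n → Fin n → Set
Adj G i j = adj G i j ≡ true

InducedIn : ∀ {k n} → Graph k → Graph n → Set
InducedIn {k} {n} H G =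
  Σ (Fin k → Fin n) λ φ →
    Injective _≡_ _≡_ φ × (∀ i j → adj G (φ i) (φ j) ≡ adj H i j)

Free : ∀ {k n} → Graph k → Graph n → Set
Free H G = InducedIn H G → ⊥

private
  +suc≢ : ∀ m q → ((m + suc q) ≡ᵇ m) ≡ false
  +suc≢ zero    q = refl
  +suc≢ (suc m) q = +suc≢ m q

  ∨-false : ∀ b → b ≡ false → (b ∨ b) ≡ false
  ∨-false .false refl = refl

pK2 : (q : ℕ) → Graph (suc q + suc q)   -- this is (q+1)K₂
pK2 q = record { adj = a ; sym = s ; irrefl = r }
  where
  p = suc q
  a : Fin (p + p) → Fin (p + p) → Bool
  a i j = ((toℕ i + p) ≡ᵇ toℕ j) ∨ ((toℕ j + p) ≡ᵇ toℕ i)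
  s : ∀ i j → a i j ≡ a j i
  s i j = ∨-comm ((toℕ i + p) ≡ᵇ toℕ j) ((toℕ j + p) ≡ᵇ toℕ i)
  r : ∀ i → a i i ≡ false
  r i = ∨-false _ (+suc≢ (toℕ i) q)

-- The butterfly: two triangles {0,1,2} and {0,3,4} sharing vertex 0.

private
  bf : Fin 5 → Fin 5 → Bool
  bf zero zero = false
  bf zero (suc _) = true
  bf (suc _) zero = true
  bf (suc zero) (suc (suc zero)) = true
  bf (suc (suc zero)) (suc zero) = true
  bf (suc (suc (suc zero))) (suc (suc (suc (suc zero)))) = true
  bf (suc (suc (suc (suc zero)))) (suc (suc (suc zero))) = true
  bf _ _ = false

  V : Set
  V = Fin 5

  all5 : (P : V → Set) → P zero → P (suc zero) → P (suc (suc zero))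
       → P (suc (suc (suc zero))) → P (suc (suc (suc (suc zero)))) → ∀ i → P i
  all5 P a b c d e zero = a
  all5 P a b c d e (suc zero) = b
  all5 P a b c d e (suc (suc zero)) = c
  all5 P a b c d e (suc (suc (suc zero))) = d
  all5 P a b c d e (suc (suc (suc (suc zero)))) = e

  bf-sym : ∀ i j → bf i j ≡ bf j i
  bf-sym = all5 _ (all5 _ refl refl refl refl refl) (all5 _ refl refl refl refl refl)
                  (all5 _ refl refl refl refl refl) (all5 _ refl refl refl refl refl)
                  (all5 _ refl refl refl refl refl)

  bf-irr : ∀ i → bf i i ≡ false
  bf-irr = all5 _ refl refl refl refl refl

butterfly : Graph 5
butterfly = record { adj = bf ; sym = bf-sym ; irrefl = bf-irr }

HasClique : ∀ {n} → Graph n → ℕ → Set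
HasClique {n} G k =
  Σ (Fin k → Fin n) λ φ →
    Injective _≡_ _≡_ φ × (∀ i j → i ≡ j ⊎ Adj G (φ i) (φ j))
  where open import Data.Sum using (_⊎_)

IsCliqueNumber : ∀ {n} → Graph n → ℕ → Set
IsCliqueNumber G w = HasClique G w × (∀ k → HasClique G k → k ≤ w)

Colourable : ∀ {n} → Graph n → ℕ → Set
Colourable {n} G k =
  Σ (Fin n → Fin k) λ c → ∀ i j → Adj G i j → (c i ≡ c j → ⊥)

-- The bounding function f_p(m) (meaningful for p ≥ 2, m ≥ 1).
-- Junk values: f p 0 = 0 (only the empty graph has ω = 0), f 0 _ = f 1 _ = 0.

f : ℕ → ℕ → ℕ
f _ zero = 0
f _ (suc zero) = 1
f zero _ = 0
f (suc zero) _ = 0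
f (suc (suc zero)) (suc (suc zero)) = 3
f (suc (suc zero)) (suc (suc (suc zero))) = 4
f (suc (suc zero)) s@(suc (suc (suc (suc _)))) = suc s C 2
f p@(suc (suc (suc _))) (suc (suc zero)) = 2 * p ∸ 2
f (suc p@(suc (suc _))) m@(suc (suc (suc _))) = f p m + (suc m C 2) ∸ 1

{-# OPTIONS --safe #-}
-- In a butterfly-free graph with a maximum clique v₀ … v_(m-1), colour a vertex by its first two
-- non-neighbours v_i, v_j in the clique, or by i alone if there is only one.  Every class is
-- stable, except that of (0 , 1): it is anticomplete to the edge v₀v₁, hence (p-1)K₂-free, and is
-- coloured by induction on p.  This gives f_p(m) = f_(p-1)(m) + C(m+1,2) - 1, and leaves two
-- exceptional values: (2K₂,K₄)-free graphs and (3K₂,K₃)-free graphs are 4-colourable.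
--
-- Both are shown by fixing a few vertices of G and colouring the others by their adjacency to
-- these; where this fails, one more vertex is fixed, and the case analysis is finite.  Its
-- starting points come from a 2K₂-free graph being bipartite unless it contains a triangle or a
-- pentagon.  In the first case this is applied to the neighbours and to the non-neighbours of a
-- vertex v: either a 5-wheel occurs, or v misses a triangle or a pentagon, or two colours suffice
-- for each part.  In the second case, for an edge ab, the neighbours of a and of b are stable, so
-- the common non-neighbours may be assumed not to be bipartite, and each edge among them then
-- lies on a pentagon among them.
module Submission where

open import Defs
open import Data.Nat using (ℕ; zero; suc; pred; _+_; _*_; _∸_; _/_; _%_; _≤_; _<_; z≤n; s≤s; z<s; s≤s⁻¹; _≡ᵇ_) renaming (_≟_ to _≟ⁿ_)
open import Data.Nat.Combinatorics using (_C_; nCk+nC[k+1]≡[n+1]C[k+1]; nC1≡n)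
open import Data.Nat.Properties using (≤-refl; ≤-reflexive; ≤-trans; ≤-total; <-≤-trans; ≤-<-trans; <⇒≱; <⇒≤; <-irrefl; <-cmp; n<1+n; n≤1+n; m<n⇒m<1+n; m≤n⇒m<n∨m≡n; pred-mono-≤; +-comm; +-assoc; +-monoˡ-<; +-monoˡ-≤; +-monoʳ-<; +-mono-≤; +-mono-≤-<; +-cancelˡ-≡; +-cancelʳ-≡; m≤m+n; m≤n+m; *-suc; ∸-monoˡ-≤; ∸-monoˡ-<; m∸n+n≡m; m+n∸n≡m; +-∸-assoc; ≡ᵇ⇒≡)
open import Data.Bool using (Bool; true; false; _∧_; _∨_; not; if_then_else_; T)
open import Data.Bool.ListAction using (any; all)
open import Data.Bool.Properties using (∧-comm) renaming (_≟_ to _≟ᵇ_)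
open import Data.Fin using (Fin; zero; suc; _≟_; toℕ; fromℕ<; inject≤; splitAt; _↑ˡ_; _↑ʳ_)
open import Data.Fin.Properties using (any?; all?; toℕ<n; toℕ-injective; toℕ-fromℕ<; toℕ-inject≤; toℕ-↑ˡ; toℕ-↑ʳ; ↑ˡ-injective; ↑ʳ-injective; splitAt-↑ˡ; splitAt-↑ʳ; splitAt⁻¹-↑ˡ; splitAt⁻¹-↑ʳ)
open import Data.List using (List; []; _∷_; _++_; map; zipWith; filterᵇ)
open import Data.List.Properties using (map-cong)
open import Data.List.Membership.Propositional using (_∈_)
open import Data.List.Membership.Propositional.Properties using (∈-++⁺ʳ; ∈-map⁻)
open import Data.List.Relation.Unary.Any using (here; there)
open import Data.Product using (Σ; ∃; _×_; _,_; proj₁; proj₂)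
open import Data.Sum using (_⊎_; inj₁; inj₂)
open import Data.Unit using (⊤; tt)
open import Data.Empty using (⊥; ⊥-elim)
open import Relation.Nullary using (¬_; Dec; yes; no; does)
open import Relation.Nullary.Decidable using (_×-dec_; _→-dec_; dec-true; from-yes)
open import Relation.Binary.Definitions using (tri<; tri≈; tri>)
open import Relation.Binary.PropositionalEquality using (_≡_; _≢_; refl; trans; cong; cong₂; subst; subst₂) renaming (sym to ≡-sym)

-- The pairs i < j ≤ m, with j = m standing for "no second non-neighbour", number C(m+1,2); all of
-- them cost one colour except (0 , 1), which costs f_(p-1)(m), hence the -1. The recursion is
-- seeded at p = 1, where a graph without edges needs one colour. With ω = 2 the step costs C(3,2) -
-- 1 = 2 colours, which is the slope of 2p - 2.
--
-- These two cases therefore need an argument of their own. G has unbounded size there, but relative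
-- to a fixed list of vertices it has only finitely many adjacency types. The excluded subgraphs
-- decide some adjacencies between types, which rules out further types and makes unions of types
-- stable. So a finite tree of choices can be checked by evaluation, and one soundness proof
-- transfers its outcome to every G.

∧-true : ∀ {a b} → a ∧ b ≡ true → a ≡ true × b ≡ true
∧-true {true} {true} _ = refl , refl

∨-true : ∀ {a b} → a ∨ b ≡ true → a ≡ true ⊎ b ≡ true
∨-true {true}  _ = inj₁ refl
∨-true {false} p = inj₂ p

not-true : ∀ {a} → not a ≡ true → a ≡ false
not-true {false} _ = refl

true≢false : ∀ {a} {A : Set} → a ≡ true → a ≡ false → A
true≢false refl ()

true-or-false : ∀ b → b ≡ true ⊎ b ≡ false
true-or-false true  = inj₁ refl
true-or-false false = inj₂ refl

∧-intro : ∀ {a b} → a ≡ true → b ≡ true → a ∧ b ≡ true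
∧-intro refl refl = refl

not-intro : ∀ {a} → a ≡ false → not a ≡ true
not-intro refl = refl

refute : ∀ {a} → (a ≡ true → ⊥) → a ≡ false
refute {true}  h = ⊥-elim (h refl)
refute {false} h = refl

affirm : ∀ {a} → (a ≡ false → ⊥) → a ≡ true
affirm {true}  h = refl
affirm {false} h = ⊥-elim (h refl)

-- Induced matchings and cliques inside a vertex set

module _ {n} (G : Graph n) where

  -- The vertices `a` and `b` drop out of the remaining set by themselves, each being a neighbour of
  -- the other; distinctness and inducedness need no separate clauses.
  Matching : ℕ → (Fin n → Bool) → Set
  Matching zero    ω = ⊤
  Matching (suc k) ω = Σ (Fin n) λ a → Σ (Fin n) λ b →
    (ω a ≡ true × ω b ≡ true × adj G a b ≡ true) ×
    Matching k (λ v → (ω v ∧ not (adj G a v)) ∧ not (adj G b v))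

  Clique : ℕ → (Fin n → Bool) → Set
  Clique zero    ω = ⊤
  Clique (suc k) ω = Σ (Fin n) λ a → ω a ≡ true × Clique k (λ v → ω v ∧ adj G a v)

  everything : Fin n → Bool
  everything _ = true

  Matching-mono : ∀ k {ω ω′} → (∀ v → ω v ≡ true → ω′ v ≡ true) → Matching k ω → Matching k ω′
  Matching-mono zero    h m = tt
  Matching-mono (suc k) h (a , b , (p , q , r) , m) =
    a , b , (h a p , h b q , r) , Matching-mono k shrink m
    where
    shrink : ∀ v → _ ≡ true → _ ≡ true
    shrink v e with ∧-true e
    ... | e′ , eb with ∧-true e′
    ...   | ev , ea = ∧-intro (∧-intro (h v ev) ea) eb

  Clique-mono : ∀ k {ω ω′} → (∀ v → ω v ≡ true → ω′ v ≡ true) → Clique k ω → Clique k ω′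
  Clique-mono zero    h c = tt
  Clique-mono (suc k) h (a , p , c) = a , h a p , Clique-mono k shrink c
    where
    shrink : ∀ v → _ ≡ true → _ ≡ true
    shrink v e with ∧-true e
    ... | ev , ea = ∧-intro (h v ev) ea

  adj-swap : ∀ {x y b} → adj G x y ≡ b → adj G y x ≡ b
  adj-swap {x} {y} e = trans (Graph.sym G y x) e

-- Boolean checks on adjacency rows

Row : Set
Row = List Bool

Matrix : Set
Matrix = List Row

some₂ : {A B : Set} → (A → B → Bool) → List A → List B → Bool
some₂ f (x ∷ xs) (y ∷ ys) = f x y ∨ some₂ f xs ys
some₂ f _ _ = false

some₃ : {A B D : Set} → (A → B → D → Bool) → List A → List B → List D → Bool
some₃ f (x ∷ xs) (y ∷ ys) (z ∷ zs) = f x y z ∨ some₃ f xs ys zs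
some₃ f _ _ _ = false

minus : Row → Row → Row
minus = zipWith (λ x y → x ∧ not y)

common : Row → Row → Row
common = zipWith _∧_

neither : Row → Row → Row
neither = zipWith (λ x y → not x ∧ not y)

matching : ℕ → Row → Matrix → Bool
matching zero    o M = true
matching (suc k) o M =
  some₂ (λ oa ra → oa ∧ some₃ (λ ob ab rb → (ob ∧ ab) ∧ matching k (minus (minus o ra) rb) M) o ra M) o M

clique : ℕ → Row → Matrix → Bool
clique zero    o M = true
clique (suc k) o M = some₂ (λ oa ra → oa ∧ clique k (common o ra) M) o M

-- Whether two rows force their vertices to be non-adjacent (apart) or adjacent (joined) in a
-- graph without induced (2+p)K₂ and without K_(2+r).

apart : ℕ → ℕ → Matrix → Row → Row → Bool
apart p r M s t = clique r (common s t) M ∨ matching (suc p) (neither s t) M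

joined : ℕ → Matrix → Row → Row → Bool
joined p M s t =
  some₃ (λ sa ta ra → (sa ∧ not ta) ∧
    some₂ (λ ob rb → ob ∧ matching p (minus (minus (neither s t) ra) rb) M)
          (minus (minus t s) ra) M) s t M

-- Soundness of the row checks for a list of vertices of a graph

module Rows {n} (G : Graph n) where

  V : Set
  V = Fin n

  row : List V → V → Row
  row φ v = map (adj G v) φ

  matrix : List V → Matrix
  matrix φ = map (row φ) φ

  zipWith-map : {A B D : Set} (f : A → B → D) (g : V → A) (h : V → B) (φ : List V) →
    zipWith f (map g φ) (map h φ) ≡ map (λ v → f (g v) (h v)) φ
  zipWith-map f g h []      = refl
  zipWith-map f g h (x ∷ φ) = cong (_ ∷_) (zipWith-map f g h φ)

  some₂-sound : {A B : Set} (f : A → B → Bool) (g : V → A) (h : V → B) (φ : List V) →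
    some₂ f (map g φ) (map h φ) ≡ true → ∃ λ v → f (g v) (h v) ≡ true
  some₂-sound f g h (x ∷ φ) e with ∨-true e
  ... | inj₁ p = x , p
  ... | inj₂ q = some₂-sound f g h φ q

  some₃-sound : {A B D : Set} (f : A → B → D → Bool) (g : V → A) (h : V → B) (k : V → D) (φ : List V) →
    some₃ f (map g φ) (map h φ) (map k φ) ≡ true → ∃ λ v → f (g v) (h v) (k v) ≡ true
  some₃-sound f g h k (x ∷ φ) e with ∨-true e
  ... | inj₁ p = x , p
  ... | inj₂ q = some₃-sound f g h k φ q

  minus₂-map : ∀ ω a b φ → minus (minus (map ω φ) (row φ a)) (row φ b) ≡
    map (λ v → (ω v ∧ not (adj G a v)) ∧ not (adj G b v)) φ
  minus₂-map ω a b φ = trans (cong (λ z → minus z (row φ b)) (zipWith-map _ ω (adj G a) φ))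
                             (zipWith-map _ _ (adj G b) φ)

  matching-sound : ∀ k ω φ → matching k (map ω φ) (matrix φ) ≡ true → Matching G k ω
  matching-sound zero    ω φ e = tt
  matching-sound (suc k) ω φ e with some₂-sound _ ω (row φ) φ e
  ... | a , e₁ with ∧-true e₁
  ...   | ωa , e₂ with some₃-sound _ ω (adj G a) (row φ) φ e₂
  ...     | b , e₃ with ∧-true e₃
  ...       | e₄ , e₅ with ∧-true e₄
  ...         | ωb , ab = a , b , (ωa , ωb , ab) , matching-sound k _ φ
                (subst (λ z → matching k z (matrix φ) ≡ true) (minus₂-map ω a b φ) e₅)

  clique-sound : ∀ k ω φ → clique k (map ω φ) (matrix φ) ≡ true → Clique G k ω
  clique-sound zero    ω φ e = tt
  clique-sound (suc k) ω φ e with some₂-sound _ ω (row φ) φ e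
  ... | a , e₁ with ∧-true e₁
  ...   | ωa , e₂ = a , ωa , clique-sound k _ φ
          (subst (λ z → clique k z (matrix φ) ≡ true) (zipWith-map _ ω (adj G a) φ) e₂)

  module _ (p r : ℕ) (noM : Matching G (suc (suc p)) (everything G) → ⊥)
                     (noC : Clique G (suc (suc r)) (everything G) → ⊥) where

    -- An edge xy would extend an r-clique among the common neighbours to K_(2+r), and a matching of
    -- p+1 edges missed by both x and y to (2+p)K₂.
    apart-sound : ∀ φ x y → apart p r (matrix φ) (row φ x) (row φ y) ≡ true → adj G x y ≡ false
    apart-sound φ x y e = refute contra
      where
      contra : adj G x y ≡ true → ⊥
      contra xy with ∨-true e
      ... | inj₁ c = noC (x , refl , y , xy ,
              clique-sound r _ φ (subst (λ z → clique r z (matrix φ) ≡ true) (zipWith-map _ (adj G x) (adj G y) φ) c))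
      ... | inj₂ m = noM (x , y , (refl , refl , xy) ,
              matching-sound (suc p) _ φ (subst (λ z → matching (suc p) z (matrix φ) ≡ true)
                                           (zipWith-map _ (adj G x) (adj G y) φ) m))

    -- Take a neighbour a of x that y misses and a neighbour b of y that x and a miss. If xy were
    -- not an edge, then xa and yb would be two edges of an induced matching, which p edges missing
    -- all four vertices complete to (2+p)K₂.
    joined-sound : ∀ φ x y → joined p (matrix φ) (row φ x) (row φ y) ≡ true → adj G x y ≡ true
    joined-sound φ x y e = affirm contra
      where
      contra : adj G x y ≡ false → ⊥
      contra xy with some₃-sound _ (adj G x) (adj G y) (row φ) φ e
      ... | a , e₁ with ∧-true e₁
      ...   | e₂ , e₃ with ∧-true e₂
      ...     | xa , ya with some₂-sound _ _ (row φ) φ (subst (λ z → some₂ (λ ob rb → ob ∧ matching p (minus (minus (neither (row φ x) (row φ y)) (row φ a)) rb) (matrix φ)) z (matrix φ) ≡ true)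
                                 (trans (cong (λ z → minus z (row φ a)) (zipWith-map _ (adj G y) (adj G x) φ))
                                        (zipWith-map _ _ (adj G a) φ)) e₃)
      ...       | b , e₄ with ∧-true e₄
      ...         | e₅ , m with ∧-true e₅
      ...           | e₆ , ab with ∧-true e₆
      ...             | yb , xb =
        noM (x , a , (refl , refl , xa) , y , b ,
             (∧-intro (not-intro xy) (not-intro (adj-swap G (not-true ya))) ,
              ∧-intro xb ab , yb) ,
             Matching-mono G p inside (matching-sound p _ φ
               (subst (λ z → matching p z (matrix φ) ≡ true)
                 (trans (cong (λ z → minus (minus z (row φ a)) (row φ b))
                              (zipWith-map _ (adj G x) (adj G y) φ))
                        (minus₂-map _ a b φ)) m)))
        where
        inside : ∀ v → ((not (adj G x v) ∧ not (adj G y v)) ∧ not (adj G a v)) ∧ not (adj G b v) ≡ true →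
                 ((not (adj G x v) ∧ not (adj G a v)) ∧ not (adj G y v)) ∧ not (adj G b v) ≡ true
        inside v with adj G x v | adj G y v | adj G a v
        ... | true  | _     | _     = λ z → z
        ... | false | true  | true  = λ z → z
        ... | false | true  | false = λ z → z
        ... | false | false | true  = λ z → z
        ... | false | false | false = λ z → z

-- Certificates

-- A certificate is a case analysis on a growing list φ of vertices of G; every index into φ
-- counts from the most recent vertex.  The type of a vertex is its adjacency row to φ, and the
-- state lists the types that may still occur.
--   leaf k       colour each vertex by its type, the colours being the base 4 digits of k;
--   split i k    is there a vertex of the i-th type?  If so, choose one with as many neighbours
--                as possible in the types picked by the binary digits of k;
--   link i j     are there adjacent vertices of the i-th and the j-th type?
--   gap          a vertex of φ has a type that was ruled out;
--   found        the given vertices of φ form a wheel, which is settled already;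
--   pent a b c d the edge cd lies on a pentagon avoiding the neighbours of the edge ab;
--   many         one certificate for each possible type of the next vertex.
data Cert : Set where
  leaf  : ℕ → Cert
  split : ℕ → ℕ → Cert → Cert → Cert
  link  : ℕ → ℕ → Cert → Cert → Cert
  gap   : Cert
  found : ℕ → ℕ → ℕ → ℕ → ℕ → ℕ → Cert
  pent  : ℕ → ℕ → ℕ → ℕ → Cert → Cert
  many  : List Cert → Cert

-- A ban forbids edges between a type and a list of types, read at the time of the ban: each
-- later vertex adds a level, below which types lose their most recent entry.
data Ban : Set where
  level : Ban
  ban   : Row → List Row → Ban

record State : Set where
  constructor state
  field
    rows  : Matrix
    bans  : List Ban
    types : List Row
open State

-- G has no induced (2+p)K₂ and no K_(2+r).
record Rules : Set where
  field
    p r    : ℕ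
    wheels pentas : Bool

sameBit : Bool → Bool → Bool
sameBit true  b = b
sameBit false b = not b

same : Row → Row → Bool
same []      []      = true
same (x ∷ s) (y ∷ t) = sameBit x y ∧ same s t
same _       _       = false

elem : Row → List Row → Bool
elem s ts = any (same s) ts

nth : {A : Set} → A → List A → ℕ → A
nth d []       i       = d
nth d (x ∷ xs) zero    = x
nth d (x ∷ xs) (suc i) = nth d xs i

at : Row → ℕ → Bool
at = nth false

banned : List Ban → Row → Row → Bool
banned (ban u us ∷ h) s       t       = (same s u ∧ elem t us) ∨ ((same t u ∧ elem s us) ∨ banned h s t)
banned (level ∷ h)    (_ ∷ s) (_ ∷ t) = banned h s t
banned _              _       _       = false

digit : ℕ → Fin 4
digit 0 = zero
digit 1 = suc zero
digit 2 = suc (suc zero)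
digit _ = suc (suc (suc zero))

colours : List Row → ℕ → List (Row × Fin 4)
colours []       k = []
colours (t ∷ ts) k = (t , digit (k % 4)) ∷ colours ts (k / 4)

choose : List Row → ℕ → List Row
choose []       k = []
choose (t ∷ ts) k = if does (k % 2 ≟ⁿ 1) then t ∷ choose ts (k / 2) else choose ts (k / 2)

isEdge : Matrix → ℕ → ℕ → Bool
isEdge M a b = at (nth [] M a) b

-- The pentagon is c d x y z, with one predicate for each of x, y and z. The indices move up by one
-- at each step, because the vertex just chosen is prepended.
pentasteps : ℕ → ℕ → ℕ → ℕ → List (Row → Bool)
pentasteps a b c d =
  (λ t → at t d ∧ (not (at t a) ∧ (not (at t b) ∧ not (at t c)))) ∷
  (λ t → at t 0 ∧ (not (at t (suc a)) ∧ (not (at t (suc b)) ∧ (not (at t (suc c)) ∧ not (at t (suc d)))))) ∷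
  (λ t → at t 0 ∧ (not (at t 1) ∧ (at t (2 + c) ∧ (not (at t (2 + a)) ∧ (not (at t (2 + b)) ∧ not (at t (2 + d))))))) ∷ []

two-edges : Matrix → ℕ → ℕ → ℕ → ℕ → Bool
two-edges M a b c d = (isEdge M a b ∧ isEdge M c d) ∧
  (not (isEdge M a c) ∧ (not (isEdge M a d) ∧ (not (isEdge M b c) ∧ not (isEdge M b d))))

pentagon : Matrix → ℕ → ℕ → ℕ → ℕ → ℕ → Bool
pentagon M a b c d e =
  (isEdge M a b ∧ (isEdge M b c ∧ (isEdge M c d ∧ (isEdge M d e ∧ isEdge M e a)))) ∧
  (not (isEdge M a c) ∧ (not (isEdge M b d) ∧ (not (isEdge M c e) ∧ (not (isEdge M d a) ∧ not (isEdge M e b)))))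

wheel : Matrix → ℕ → ℕ → ℕ → ℕ → ℕ → ℕ → Bool
wheel M h a b c d e = pentagon M a b c d e ∧
  (isEdge M h a ∧ (isEdge M h b ∧ (isEdge M h c ∧ (isEdge M h d ∧ isEdge M h e))))

-- The certificate checker

module Check (R : Rules) where
  open Rules R

  separated : State → Row → Row → Bool
  separated st s t = banned (bans st) s t ∨ apart p r (rows st) s t

  -- Every old type splits in two according to its adjacency to the new vertex. The list only bounds
  -- the types from above: keeping a type that no vertex has is harmless, and only dropping one
  -- needs a reason.
  grow : State → Row → List Row → List Row
  grow st t []       = []
  grow st t (s ∷ ss) =
    (if separated st s t then [] else (true ∷ s) ∷ []) ++
    ((if joined p (rows st) s t then [] else (false ∷ s) ∷ []) ++ grow st t ss)

  extend : Row → State → State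
  extend t st = state ((false ∷ t) ∷ zipWith _∷_ t (rows st)) (level ∷ bans st) (grow st t (types st))

  forbid : Row → List Row → State → State
  forbid s ts st = state (rows st) (ban s ts ∷ bans st) (types st)

  remove : Row → State → State
  remove s st = state (rows st) (bans st) (filterᵇ (λ t → not (same t s)) (types st))

  stable : State → List Row → Bool
  stable st []       = true
  stable st (s ∷ ss) = separated st s s ∧ (all (separated st s) ss ∧ stable st ss)

  isZero : ℕ → Bool
  isZero zero    = true
  isZero (suc _) = false

  -- Between two stable sets of a 2K₂-free graph the neighbourhoods form a chain, so a vertex with
  -- the most neighbours sees all that the others see.
  dominable : State → Row → List Row → Bool
  dominable st s [] = true
  dominable st s ts = isZero p ∧ (separated st s s ∧ stable st ts)

  compatible : State → Row → Fin 4 → Row × Fin 4 → Bool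
  compatible st s c (t , d) = not (does (c ≟ d)) ∨ separated st s t

  proper : State → List (Row × Fin 4) → Bool
  proper st []              = true
  proper st ((s , c) ∷ scs) = separated st s s ∧
    (all (compatible st s c) scs ∧ proper st scs)

  -- If the four indices do not describe two induced edges, the chain is empty and `pent` adds no
  -- vertex, so a wrong certificate cannot cause unsoundness.
  pentachain : Matrix → ℕ → ℕ → ℕ → ℕ → List (Row → Bool)
  pentachain M a b c d = if pentas ∧ two-edges M a b c d then pentasteps a b c d else []

  check      : Cert → State → Bool
  checkChain : List (Row → Bool) → State → Cert → Bool
  checkAll   : List (Row → Bool) → List Row → State → List Cert → Bool

  check (leaf k)         st = proper st (colours (types st) k)
  check (split i k c d) st = let s = nth [] (types st) i ; ts = choose (types st) k in
    -- The ban records the extremal choice: what the new vertex misses in `ts` is missed by the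
    -- other vertices of its type too.
    dominable st s ts ∧ (check c (forbid (false ∷ s) (map (false ∷_) ts) (extend s st)) ∧ check d (remove s st))
  check (link i j c d)   st = let s = nth [] (types st) i ; t = nth [] (types st) j in
    check c (extend (true ∷ t) (extend s st)) ∧ check d (forbid s (t ∷ []) st)
  check gap              st = any (λ s → not (elem s (types st))) (rows st)
  check (found h a b c d e) st = wheels ∧ wheel (rows st) h a b c d e
  check (pent a b c d e) st = checkChain (pentachain (rows st) a b c d) st e
  check (many _)         st = false

  checkChain []       st e         = check e st
  checkChain (m ∷ ms) st (many es) = checkAll ms (filterᵇ m (types st)) st es
  checkChain (m ∷ ms) st _         = false

  checkAll ms []       st es       = true
  checkAll ms (t ∷ ts) st []       = false
  checkAll ms (t ∷ ts) st (e ∷ es) = checkChain ms (extend t st) e ∧ checkAll ms ts st es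

  build : List Row → State
  build []       = state [] [] ([] ∷ [])
  build (t ∷ ts) = extend t (build ts)

-- Finite extrema and counting

count : ∀ {n} → (Fin n → Bool) → ℕ
count {zero}  p = 0
count {suc n} p = (if p zero then 1 else 0) + count (λ i → p (suc i))

bit-mono : ∀ a b → (a ≡ true → b ≡ true) → (if a then 1 else 0) ≤ (if b then 1 else 0)
bit-mono false b     h = z≤n
bit-mono true  true  h = ≤-refl
bit-mono true  false h with () ← h refl

count-mono : ∀ {n} (p q : Fin n → Bool) → (∀ i → p i ≡ true → q i ≡ true) → count p ≤ count q
count-mono {zero}  p q h = z≤n
count-mono {suc n} p q h = +-mono-≤ (bit-mono (p zero) (q zero) (h zero)) (count-mono _ _ (λ i → h (suc i)))

count-strict : ∀ {n} (p q : Fin n → Bool) → (∀ i → p i ≡ true → q i ≡ true) →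
               ∀ i → p i ≡ false → q i ≡ true → count p < count q
count-strict p q h zero    e e′ rewrite e | e′ = s≤s (count-mono _ _ (λ i → h (suc i)))
count-strict p q h (suc i) e e′ =
  +-mono-≤-< (bit-mono (p zero) (q zero) (h zero)) (count-strict _ _ (λ i → h (suc i)) i e e′)

argmax : ∀ {n} (P : Fin n → Bool) (f : Fin n → ℕ) →
  (∀ y → P y ≡ false) ⊎ (∃ λ x → P x ≡ true × (∀ y → P y ≡ true → f y ≤ f x))
argmax {zero}  P f = inj₁ λ ()
argmax {suc n} P f with argmax (λ i → P (suc i)) (λ i → f (suc i)) | true-or-false (P zero)
... | inj₁ none | inj₂ e = inj₁ λ { zero → e ; (suc y) → none y }
... | inj₁ none | inj₁ e = inj₂ (zero , e , λ { zero _ → ≤-refl ; (suc y) e′ → true≢false e′ (none y) })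
... | inj₂ (x , ex , best) | inj₂ e = inj₂ (suc x , ex , λ { zero e′ → true≢false e′ e ; (suc y) e′ → best y e′ })
... | inj₂ (x , ex , best) | inj₁ e with ≤-total (f zero) (f (suc x))
...   | inj₁ le = inj₂ (suc x , ex , λ { zero _ → le ; (suc y) e′ → best y e′ })
...   | inj₂ ge = inj₂ (zero , e , λ { zero _ → ≤-refl ; (suc y) e′ → ≤-trans (best y e′) ge })

-- Soundness of the checker

same-sound : ∀ s t → same s t ≡ true → s ≡ t
same-sound []          []          e = refl
same-sound (true ∷ s)  (true ∷ t)  e = cong (true ∷_) (same-sound s t e)
same-sound (false ∷ s) (false ∷ t) e = cong (false ∷_) (same-sound s t e)

same-refl : ∀ s → same s s ≡ true
same-refl []          = refl
same-refl (true ∷ s)  = same-refl s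
same-refl (false ∷ s) = same-refl s

elem-sound : ∀ s ts → elem s ts ≡ true → s ∈ ts
elem-sound s (t ∷ ts) e with ∨-true e
... | inj₁ h = here (same-sound s t h)
... | inj₂ h = there (elem-sound s ts h)

elem-complete : ∀ s ts → s ∈ ts → elem s ts ≡ true
elem-complete s (t ∷ ts) (here refl) rewrite same-refl s = refl
elem-complete s (t ∷ ts) (there h) with same s t
... | true  = refl
... | false = elem-complete s ts h

filterᵇ-∈ : ∀ (m : Row → Bool) {t} ts → t ∈ ts → m t ≡ true → t ∈ filterᵇ m ts
filterᵇ-∈ m (u ∷ ts) (here refl) e rewrite e = here refl
filterᵇ-∈ m (u ∷ ts) (there h) e with m u
... | true  = there (filterᵇ-∈ m ts h e)
... | false = filterᵇ-∈ m ts h e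

all-sound : ∀ {A : Set} (f : A → Bool) xs {x} → all f xs ≡ true → x ∈ xs → f x ≡ true
all-sound f (y ∷ xs) e (here refl) = proj₁ (∧-true e)
all-sound f (y ∷ xs) e (there h)   = all-sound f xs (proj₂ (∧-true e)) h

colourOf : List (Row × Fin 4) → Row → Fin 4
colourOf []             s = zero
colourOf ((t , c) ∷ cs) s = if same s t then c else colourOf cs s

colourOf-∈ : ∀ ts k s → s ∈ ts → (s , colourOf (colours ts k) s) ∈ colours ts k
colourOf-∈ (t ∷ ts) k s h with same s t in e
... | true with refl ← same-sound s t e = here refl
colourOf-∈ (t ∷ ts) k s (here refl) | false = true≢false (same-refl s) e
colourOf-∈ (t ∷ ts) k s (there h)   | false = there (colourOf-∈ ts (k / 4) s h)

-- Configurations to which the certificates appeal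

record Pentagon {n} (G : Graph n) (a b c d e : Fin n) : Set where
  constructor pentagon✓
  field
    ab : adj G a b ≡ true
    bc : adj G b c ≡ true
    cd : adj G c d ≡ true
    de : adj G d e ≡ true
    ea : adj G e a ≡ true
    ac : adj G a c ≡ false
    bd : adj G b d ≡ false
    ce : adj G c e ≡ false
    da : adj G d a ≡ false
    eb : adj G e b ≡ false

record Wheel {n} (G : Graph n) (h a b c d e : Fin n) : Set where
  constructor wheel✓
  field
    rim : Pentagon G a b c d e
    ha  : adj G h a ≡ true
    hb  : adj G h b ≡ true
    hc  : adj G h c ≡ true
    hd  : adj G h d ≡ true
    he  : adj G h e ≡ true

record Matching₂ {n} (G : Graph n) (a b c d : Fin n) : Set where
  constructor matching✓
  field
    ab : adj G a b ≡ true
    cd : adj G c d ≡ true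
    ac : adj G a c ≡ false
    ad : adj G a d ≡ false
    bc : adj G b c ≡ false
    bd : adj G b d ≡ false

record Avoids {n} (G : Graph n) (a b x : Fin n) : Set where
  constructor avoids
  field
    xa : adj G x a ≡ false
    xb : adj G x b ≡ false

PentagonAvoiding : ∀ {n} → Graph n → (a b c d : Fin n) → Set
PentagonAvoiding G a b c d = ∃ λ x → ∃ λ y → ∃ λ z →
  Pentagon G c d x y z × Avoids G a b x × Avoids G a b y × Avoids G a b z

module Soundness {n} (G : Graph n) (R : Rules)
  (noM : Matching G (suc (suc (Rules.p R))) (everything G) → ⊥)
  (noC : Clique G (suc (suc (Rules.r R))) (everything G) → ⊥)
  (onWheel : Rules.wheels R ≡ true → ∀ h a b c d e → Wheel G h a b c d e → Colourable G 4)
  (onPenta : Rules.pentas R ≡ true → ∀ a b c d → Matching₂ G a b c d →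
             Colourable G 4 ⊎ PentagonAvoiding G a b c d)
  where
  open Rules R
  open Rows G
  open Check R

  Obeys : List Ban → List V → Set
  Obeys []             φ       = ⊤
  Obeys (ban s ts ∷ h) φ       = (∀ x y → row φ x ≡ s → row φ y ∈ ts → adj G x y ≡ false) × Obeys h φ
  Obeys (level ∷ h)    []      = ⊤
  Obeys (level ∷ h)    (z ∷ φ) = Obeys h φ

  record Inv (st : State) (φ : List V) : Set where
    constructor inv
    field
      rows≡ : State.rows st ≡ matrix φ
      obeys : Obeys (State.bans st) φ
      typed : ∀ v → row φ v ∈ State.types st

  banned-sound : ∀ h φ x y → Obeys h φ → banned h (row φ x) (row φ y) ≡ true → adj G x y ≡ false
  banned-sound (level ∷ h) (z ∷ φ) x y o e = banned-sound h φ x y o e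
  banned-sound (ban u us ∷ h) φ x y (o , os) e with ∨-true e
  ... | inj₁ e₁ = o x y (same-sound _ _ (proj₁ (∧-true e₁))) (elem-sound _ _ (proj₂ (∧-true e₁)))
  ... | inj₂ e₁ with ∨-true e₁
  ...   | inj₁ e₂ = adj-swap G (o y x (same-sound _ _ (proj₁ (∧-true e₂))) (elem-sound _ _ (proj₂ (∧-true e₂))))
  ...   | inj₂ e₂ = banned-sound h φ x y os e₂

  separated-sound : ∀ {st φ} → Inv st φ → ∀ x y {s t} → row φ x ≡ s → row φ y ≡ t →
    separated st s t ≡ true → adj G x y ≡ false
  separated-sound {st} {φ} (inv refl o _) x y refl refl e with ∨-true e
  ... | inj₁ e₁ = banned-sound (State.bans st) φ x y o e₁
  ... | inj₂ e₁ = apart-sound p r noM noC φ x y e₁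

  grow-∈ : ∀ st t b {s} ss → s ∈ ss → (b ≡ true → separated st s t ≡ false) →
    (b ≡ false → joined p (State.rows st) s t ≡ false) → (b ∷ s) ∈ grow st t ss
  grow-∈ st t true  (s ∷ ss) (here refl) h₁ h₂ rewrite h₁ refl = here refl
  grow-∈ st t false (s ∷ ss) (here refl) h₁ h₂ rewrite h₂ refl =
    ∈-++⁺ʳ (if separated st s t then [] else _) (here refl)
  grow-∈ st t b (u ∷ ss) (there m) h₁ h₂ =
    ∈-++⁺ʳ (if separated st u t then [] else _)
      (∈-++⁺ʳ (if joined p (State.rows st) u t then [] else _) (grow-∈ st t b ss m h₁ h₂))

  extend-sound : ∀ {st φ} → Inv st φ → ∀ x {t} → row φ x ≡ t → Inv (extend t st) (x ∷ φ)
  extend-sound {st} {φ} I@(inv refl o ty) x refl = inv rows′ o types′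
    where
    rows′ : (false ∷ row φ x) ∷ zipWith _∷_ (row φ x) (matrix φ) ≡ matrix (x ∷ φ)
    rows′ = cong₂ _∷_ (cong (_∷ row φ x) (≡-sym (irrefl G x)))
      (trans (zipWith-map _∷_ (adj G x) (row φ) φ)
             (map-cong (λ v → cong (_∷ row φ v) (Graph.sym G x v)) φ))
    types′ : ∀ v → (adj G v x ∷ row φ v) ∈ grow st (row φ x) (State.types st)
    types′ v = grow-∈ st (row φ x) (adj G v x) (State.types st) (ty v)
      (λ e → refute λ s → true≢false e (separated-sound I v x refl refl s))
      (λ e → refute λ j → true≢false (joined-sound p r noM noC φ v x j) e)

  remove-sound : ∀ {st φ} → Inv st φ → ∀ s → (∀ x → row φ x ≡ s → ⊥) → Inv (remove s st) φ
  remove-sound {st} {φ} (inv e o ty) s none = inv e o λ v →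
    filterᵇ-∈ _ (State.types st) (ty v) (not-intro (refute λ h → none v (same-sound _ _ h)))

  forbid-sound : ∀ {st φ} → Inv st φ → ∀ s ts →
    (∀ x y → row φ x ≡ s → row φ y ∈ ts → adj G x y ≡ false) → Inv (forbid s ts st) φ
  forbid-sound (inv e o ty) s ts h = inv e (h , o) ty

  stable-sound : ∀ {st φ} → Inv st φ → ∀ ts → stable st ts ≡ true → ∀ x y →
    row φ x ∈ ts → row φ y ∈ ts → adj G x y ≡ false
  stable-sound {st} I (t ∷ ts) e x y hx hy
    with ∧-true {separated st t t} {all (separated st t) ts ∧ stable st ts} e
  stable-sound {st} I (t ∷ ts) e x y (here hx) (here hy)   | e₁ , _ = separated-sound I x y hx hy e₁
  stable-sound {st} I (t ∷ ts) e x y (here hx) (there hy)  | _ , e₂ =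
    separated-sound I x y hx refl (all-sound (separated st t) ts (proj₁ (∧-true e₂)) hy)
  stable-sound {st} I (t ∷ ts) e x y (there hx) (here hy)  | _ , e₂ =
    adj-swap G (separated-sound I y x hy refl (all-sound (separated st t) ts (proj₁ (∧-true e₂)) hx))
  stable-sound {st} I (t ∷ ts) e x y (there hx) (there hy) | _ , e₂ =
    stable-sound I ts (proj₂ (∧-true e₂)) x y hx hy

  proper-sound : ∀ {st φ} → Inv st φ → ∀ scs → proper st scs ≡ true → ∀ x y {c} →
    (row φ x , c) ∈ scs → (row φ y , c) ∈ scs → adj G x y ≡ false
  proper-sound {st} I ((s , c) ∷ scs) e x y hx hy
    with ∧-true {separated st s s} {all (compatible st s c) scs ∧ proper st scs} e
  proper-sound {st} {φ} I (_ ∷ scs) e x y (here refl) (here h)   | e₁ , _ =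
    separated-sound I x y refl (cong proj₁ h) e₁
  proper-sound {st} {φ} I (_ ∷ scs) e x y {c} (here refl) (there h)  | _ , e₂ with ∨-true (all-sound (compatible st (row φ x) c) scs (proj₁ (∧-true e₂)) h)
  ... | inj₁ d = true≢false (dec-true (c ≟ c) refl) (not-true d)
  ... | inj₂ s = separated-sound I x y refl refl s
  proper-sound {st} {φ} I (_ ∷ scs) e x y {c} (there h) (here refl)  | _ , e₂ with ∨-true (all-sound (compatible st (row φ y) c) scs (proj₁ (∧-true e₂)) h)
  ... | inj₁ d = true≢false (dec-true (c ≟ c) refl) (not-true d)
  ... | inj₂ s = adj-swap G (separated-sound I y x refl refl s)
  proper-sound I (_ ∷ scs) e x y (there hx) (there hy) | _ , e₂ =
    proper-sound I scs (proj₂ (∧-true e₂)) x y hx hy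

  -- A vertex with the most neighbours in the stable set T dominates: a neighbour in T of
  -- another vertex of the same type that it misses would give an induced 2K₂.
  dominator : ∀ {st φ} → Inv st φ → ∀ s ts → dominable st s ts ≡ true →
    (∀ x → row φ x ≡ s → ⊥) ⊎
    (∃ λ x → row φ x ≡ s × (∀ x′ y → row φ x′ ≡ s → row φ y ∈ ts → adj G y x ≡ false → adj G x′ y ≡ false))
  dominator {st} {φ} I s [] e with any? (λ x → same (row φ x) s ≟ᵇ true)
  ... | yes (x , h) = inj₂ (x , same-sound _ _ h , λ x′ y _ ())
  ... | no none     = inj₁ λ x h → none (x , subst (λ z → same z s ≡ true) (≡-sym h) (same-refl s))
  dominator {st} {φ} I s ts@(_ ∷ _) e with ∧-true e
  ... | p0 , e₁ with ∧-true e₁ | argmax (λ x → same (row φ x) s) (λ x → count (λ y → adj G x y ∧ elem (row φ y) ts))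
  ...   | _ | inj₁ none = inj₁ λ x h → true≢false (subst (λ z → same z s ≡ true) (≡-sym h) (same-refl s)) (none x)
  ...   | ss , stab | inj₂ (x , h , best) = inj₂ (x , sx , dominates)
    where
    sx : row φ x ≡ s
    sx = same-sound _ _ h
    no2K₂ : Matching G 2 (everything G) → ⊥
    no2K₂ = subst (λ q → Matching G (suc (suc q)) (everything G) → ⊥) (isZero-sound p p0) noM
      where
      isZero-sound : ∀ q → isZero q ≡ true → q ≡ 0
      isZero-sound zero _ = refl
    dominates : ∀ x′ y → row φ x′ ≡ s → row φ y ∈ ts → adj G y x ≡ false → adj G x′ y ≡ false
    dominates x′ y sx′ ty yx = refute contra
      where
      contra : adj G x′ y ≡ true → ⊥
      contra x′y with any? (λ z → (adj G x z ∧ elem (row φ z) ts ≟ᵇ true) ×-dec (adj G x′ z ≟ᵇ false))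
      ... | yes (z , xz , x′z) = no2K₂ (x , z , (refl , refl , proj₁ (∧-true xz)) , x′ , y ,
              (∧-intro (not-intro (separated-sound I x x′ sx sx′ ss)) (not-intro (adj-swap G x′z)) ,
               ∧-intro (not-intro (adj-swap G yx))
                       (not-intro (stable-sound I ts stab z y (elem-sound _ ts (proj₂ (∧-true xz))) ty)) ,
               x′y) , tt)
      ... | no none = <⇒≱ (count-strict _ _ sub y (refute λ q → true≢false (proj₁ (∧-true q)) (adj-swap G yx))
                                                  (∧-intro x′y (elem-complete _ ts ty)))
                          (best x′ (subst (λ z → same z s ≡ true) (≡-sym sx′) (same-refl s)))
        where
        sub : ∀ z → adj G x z ∧ elem (row φ z) ts ≡ true → adj G x′ z ∧ elem (row φ z) ts ≡ true
        sub z q = ∧-intro (affirm λ f → none (z , q , f)) (proj₂ (∧-true q))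

  -- One vertex `w` has to serve every map `g` at once: the same index is read both as a column of
  -- rows and as a row of the matrix.
  position : ∀ (φ : List V) i →
    (∃ λ w → ∀ {A : Set} (g : V → A) d → nth d (map g φ) i ≡ g w) ⊎
    (∀ {A : Set} (g : V → A) d → nth d (map g φ) i ≡ d)
  position []      i       = inj₂ λ g d → refl
  position (x ∷ φ) zero    = inj₁ (x , λ g d → refl)
  position (x ∷ φ) (suc i) = position φ i

  record Located (φ : List V) (i : ℕ) : Set where
    constructor located
    field
      vertex : V
      reads  : ∀ v → at (row φ v) i ≡ adj G v vertex
      rowAt  : nth [] (matrix φ) i ≡ row φ vertex
  open Located

  edge-reads : ∀ {φ i j} (a : Located φ i) (b : Located φ j) →
    isEdge (matrix φ) i j ≡ adj G (vertex a) (vertex b)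
  edge-reads {φ} {i} {j} a b = trans (cong (λ z → at z j) (rowAt a)) (reads b (vertex a))

  present : ∀ {φ i j} (x : Located φ i) (y : Located φ j) → isEdge (matrix φ) i j ≡ true →
    adj G (vertex x) (vertex y) ≡ true
  present x y e = trans (≡-sym (edge-reads x y)) e

  absent : ∀ {φ i j} (x : Located φ i) (y : Located φ j) → not (isEdge (matrix φ) i j) ≡ true →
    adj G (vertex x) (vertex y) ≡ false
  absent x y e = trans (≡-sym (edge-reads x y)) (not-true e)

  -- Beyond the end of the list every entry reads `false`, so a recorded edge proves that its index
  -- is a genuine position.
  source : ∀ φ i j → isEdge (matrix φ) i j ≡ true → Located φ i
  source φ i j e with position φ i
  ... | inj₁ (w , h) = located w (λ v → h (adj G v) false) (h (row φ) [])
  ... | inj₂ h rewrite h (row φ) [] with () ← e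

  target : ∀ φ i j → isEdge (matrix φ) i j ≡ true → Located φ j
  target φ i j e with position φ j
  ... | inj₁ (w , h) = located w (λ v → h (adj G v) false) (h (row φ) [])
  ... | inj₂ h = true≢false e (trans (cong (λ z → at z j) (rowAt (source φ i j e))) (h _ false))

  wheel-sound : ∀ φ h a b c d e → wheel (matrix φ) h a b c d e ≡ true →
    ∃ λ h′ → ∃ λ a′ → ∃ λ b′ → ∃ λ c′ → ∃ λ d′ → ∃ λ e′ → Wheel G h′ a′ b′ c′ d′ e′
  wheel-sound φ h a b c d e t with ∧-true t
  ... | pt , t₁ with ∧-true t₁ | ∧-true pt
  ... | ha , t₂ | edges , nonedges with ∧-true t₂ | ∧-true edges | ∧-true nonedges
  ... | hb , t₃ | ab , u₁ | ac , w₁ with ∧-true t₃ | ∧-true u₁ | ∧-true w₁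
  ... | hc , t₄ | bc , u₂ | bd , w₂ with ∧-true t₄ | ∧-true u₂ | ∧-true w₂
  ... | hd , he | cd , u₃ | ce , w₃ with ∧-true u₃ | ∧-true w₃
  ... | de , ea | da , eb =
    _ , _ , _ , _ , _ , _ ,
    wheel✓ (pentagon✓ (present aᵛ bᵛ ab) (present bᵛ cᵛ bc) (present cᵛ dᵛ cd) (present dᵛ eᵛ de) (present eᵛ aᵛ ea)
                      (absent aᵛ cᵛ ac) (absent bᵛ dᵛ bd) (absent cᵛ eᵛ ce) (absent dᵛ aᵛ da) (absent eᵛ bᵛ eb))
           (present hᵛ aᵛ ha) (present hᵛ bᵛ hb) (present hᵛ cᵛ hc) (present hᵛ dᵛ hd) (present hᵛ eᵛ he)
    where
    hᵛ = source φ h a ha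
    aᵛ = source φ a b ab
    bᵛ = source φ b c bc
    cᵛ = source φ c d cd
    dᵛ = source φ d e de
    eᵛ = source φ e a ea

  Chain : List (Row → Bool) → List V → Set
  Chain []       φ = ⊤
  Chain (m ∷ ms) φ = ∃ λ x → m (row φ x) ≡ true × Chain ms (x ∷ φ)

  pentachain-sound : ∀ φ a b c d → Colourable G 4 ⊎ Chain (pentachain (matrix φ) a b c d) φ
  pentachain-sound φ a b c d with pentas ∧ two-edges (matrix φ) a b c d in eq
  ... | false = inj₂ tt
  ... | true with ∧-true eq
  ... | pe , t with ∧-true t
  ... | t₁ , t₂ with ∧-true t₁ | ∧-true t₂
  ... | ab , cd | ac , t₃ with ∧-true t₃
  ... | ad , t₄ with ∧-true t₄
  ... | bc , bd with onPenta pe (vertex aᵛ) (vertex bᵛ) (vertex cᵛ) (vertex dᵛ)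
                       (matching✓ (present aᵛ bᵛ ab) (present cᵛ dᵛ cd) (absent aᵛ cᵛ ac) (absent aᵛ dᵛ ad) (absent bᵛ cᵛ bc) (absent bᵛ dᵛ bd))
    where
    aᵛ = source φ a b ab
    bᵛ = target φ a b ab
    cᵛ = source φ c d cd
    dᵛ = target φ c d cd
  ... | inj₁ col = inj₁ col
  ... | inj₂ (x , y , z , pentagon✓ _ dx xy yz zc cx dy xz yc zd , avoids xa xb , avoids ya yb , avoids za zb) =
    inj₂ (x , ∧-intro (has dᵛ x (adj-swap G dx)) (∧-intro (lacks aᵛ x xa) (∧-intro (lacks bᵛ x xb) (lacks cᵛ x (adj-swap G cx)))) ,
          y , ∧-intro (adj-swap G xy) (∧-intro (lacks aᵛ y ya) (∧-intro (lacks bᵛ y yb) (∧-intro (lacks cᵛ y yc) (lacks dᵛ y (adj-swap G dy))))) ,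
          z , ∧-intro (adj-swap G yz) (∧-intro (not-intro (adj-swap G xz)) (∧-intro (has cᵛ z zc)
                (∧-intro (lacks aᵛ z za) (∧-intro (lacks bᵛ z zb) (lacks dᵛ z zd))))) , tt)
    where
    aᵛ = source φ a b ab
    bᵛ = target φ a b ab
    cᵛ = source φ c d cd
    dᵛ = target φ c d cd
    has : ∀ {i} (w : Located φ i) v → adj G v (vertex w) ≡ true → at (row φ v) i ≡ true
    has w v q = trans (reads w v) q
    lacks : ∀ {i} (w : Located φ i) v → adj G v (vertex w) ≡ false → not (at (row φ v) i) ≡ true
    lacks w v q = not-intro (trans (reads w v) q)

  check-sound : ∀ e st φ → Inv st φ → check e st ≡ true → Colourable G 4
  chain-sound : ∀ ms e st φ → Inv st φ → Chain ms φ → checkChain ms st e ≡ true → Colourable G 4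
  checkAll-sound : ∀ ms ts es st φ → Inv st φ → ∀ x → row φ x ∈ ts → Chain ms (x ∷ φ) →
    checkAll ms ts st es ≡ true → Colourable G 4

  check-sound (leaf k) st φ I t = (λ v → colourOf cs (row φ v)) , λ x y xy same-colour →
    true≢false xy (proper-sound I cs t x y (mem x)
      (subst (λ c → (row φ y , c) ∈ cs) (≡-sym same-colour) (mem y)))
    where
    cs = colours (State.types st) k
    mem : ∀ v → (row φ v , colourOf cs (row φ v)) ∈ cs
    mem v = colourOf-∈ (State.types st) k (row φ v) (Inv.typed I v)
  check-sound (split i k c d) st φ I t with ∧-true t
  ... | dom , t₁ with ∧-true t₁ | dominator I (nth [] (State.types st) i) (choose (State.types st) k) dom
  ... | _  , td | inj₁ none = check-sound d _ φ (remove-sound I _ none) td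
  ... | tc , _  | inj₂ (x , sx , dominates) = check-sound c _ (x ∷ φ)
    (forbid-sound (extend-sound I x sx) _ _ λ x′ y hx′ hy → let (u , u∈ , eq) = ∈-map⁻ (false ∷_) hy in
      dominates x′ y (tail≡ hx′) (subst (_∈ _) (≡-sym (tail≡ eq)) u∈) (head≡ eq)) tc
    where
    tail≡ : ∀ {a b : Bool} {s t} → a ∷ s ≡ b ∷ t → s ≡ t
    tail≡ refl = refl
    head≡ : ∀ {a b : Bool} {s t : Row} → a ∷ s ≡ b ∷ t → a ≡ b
    head≡ refl = refl
  check-sound (link i j c d) st φ I t with ∧-true t
  ... | tc , td with any? (λ x → any? (λ y → (same (row φ x) (nth [] (State.types st) i) ≟ᵇ true) ×-dec
                      ((same (row φ y) (nth [] (State.types st) j) ≟ᵇ true) ×-dec (adj G x y ≟ᵇ true))))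
  ... | yes (x , y , hx , hy , xy) = check-sound c _ (y ∷ x ∷ φ)
    (extend-sound (extend-sound I x (same-sound _ _ hx)) y (cong₂ _∷_ (adj-swap G xy) (same-sound _ _ hy))) tc
  ... | no none = check-sound d _ φ (forbid-sound I _ _ λ { x y hx (here hy) → refute λ xy →
      none (x , y , trans (cong (λ z → same z s) hx) (same-refl s) ,
                    trans (cong (λ z → same z t′) hy) (same-refl t′) , xy) }) td
    where
    s  = nth [] (State.types st) i
    t′ = nth [] (State.types st) j
  check-sound gap st φ (inv refl o ty) t = ⊥-elim (missing φ t)
    where
    missing : ∀ ψ → any (λ s → not (elem s (State.types st))) (map (row φ) ψ) ≡ true → ⊥
    missing (x ∷ ψ) q with ∨-true q
    ... | inj₁ e = true≢false (elem-complete _ _ (ty x)) (not-true e)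
    ... | inj₂ e = missing ψ e
  check-sound (found h a b c d e) st φ (inv refl o ty) t with ∧-true t
  ... | w , t₁ with wheel-sound φ h a b c d e t₁
  ...   | _ , _ , _ , _ , _ , _ , W = onWheel w _ _ _ _ _ _ W
  check-sound (pent a b c d e) st φ I@(inv refl o ty) t with pentachain-sound φ a b c d
  ... | inj₁ col   = col
  ... | inj₂ chain = chain-sound _ e st φ I chain t

  chain-sound []       e         st φ I ch t = check-sound e st φ I t
  chain-sound (m ∷ ms) (many es) st φ I (x , mx , ch) t =
    checkAll-sound ms _ es st φ I x (filterᵇ-∈ m (State.types st) (Inv.typed I x) mx) ch t

  checkAll-sound ms (u ∷ ts) (e ∷ es) st φ I x (here refl) ch t =
    chain-sound ms e _ (x ∷ φ) (extend-sound I x refl) ch (proj₁ (∧-true t))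
  checkAll-sound ms (u ∷ ts) (e ∷ es) st φ I x (there h) ch t =
    checkAll-sound ms ts es st φ I x h ch (proj₂ (∧-true t))

  Realises : List Row → List V → Set
  Realises []       []      = ⊤
  Realises (t ∷ ts) (x ∷ φ) = row φ x ≡ t × Realises ts φ
  Realises _        _       = ⊥

  build-sound : ∀ ts φ → Realises ts φ → Inv (build ts) φ
  build-sound []       []      _        = inv refl tt λ v → here refl
  build-sound (t ∷ ts) (x ∷ φ) (e , es) = extend-sound (build-sound ts φ es) x e

  -- Only `Realises` speaks of `G`; the Boolean premise depends on the rules, the rows and the
  -- certificate alone, so for concrete ones it holds by `refl`.
  certified : ∀ ts e φ → Realises ts φ → Check.check R e (Check.build R ts) ≡ true → Colourable G 4
  certified ts e φ h t = check-sound e (build ts) φ (build-sound ts φ h) t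

-- The certificates of the two exceptional cases, found by computer search

-- The vertices are the hub h and then e, d, c, b, a; each row covers only the vertices fixed
-- earlier, since `extend` fills in the rest by symmetry.
wheelRows : List Row
wheelRows = (true ∷ true ∷ true ∷ true ∷ true ∷ []) ∷ (true ∷ false ∷ false ∷ true ∷ []) ∷ (true ∷
  false ∷ false ∷ []) ∷ (true ∷ false ∷ []) ∷ (true ∷ []) ∷ ([]) ∷ []

wheelCert : Cert
wheelCert = split 2 2621696 (split 3 4211712 (split 4 28180480 (split 0 15433728 (leaf
  2462247484916821) (gap)) (split 7 724992 (leaf 25700747268096) (split 9 786496 (leaf
  23548949123072) (split 6 60928 (leaf 3367170344277) (split 7 320256 (leaf 4054197216597) (split 9
  16398 (split 8 238652 (leaf 170074985846101) (gap)) (leaf 11521720789))))))) (split 12 6292160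
  (split 4 8478720 (leaf 38938183857509) (split 1 6554144 (leaf 23844971981312) (split 0 7348800
  (leaf 95291373436294448) (gap)))) (split 4 3198976 (split 12 1180968 (leaf 7336978805292917)
  (gap)) (split 9 26624 (split 12 264488 (leaf 1164136767146) (split 13 131296 (leaf 731704786943)
  (link 11 4 (leaf 7160022784) (leaf 5712902826)))) (split 11 352 (split 8 164904 (leaf
  1096663705258) (split 2 132352 (leaf 437995066368) (link 4 3 (leaf 2671420672) (leaf
  23083914240)))) (split 6 513 (split 14 704 (leaf 1088139864746) (split 4 98368 (leaf 6062074624)
  (split 0 1016000 (leaf 28242652588373) (gap)))) (split 1 66176 (split 14 2432 (leaf 1631723813888)
  (link 9 3 (leaf 28646394368) (leaf 376519622400))) (split 2 33088 (split 12 88 (leaf 1525372096)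
  (split 6 4134 (split 0 1028096 (leaf 1225580282728192) (gap)) (split 0 256032 (leaf
  304058272565808) (gap)))) (split 0 128016 (leaf 304355251606336) (gap)))))))))) (split 2 1065472
  (split 11 6292288 (split 4 9056256 (leaf 38526294914393) (split 3 6316288 (leaf 42492065982512)
  (split 0 7864896 (leaf 99064392172697024) (gap)))) (split 19 832 (split 7 151564 (leaf
  4352215148714) (split 8 34821 (leaf 3300036373162) (split 4 327808 (leaf 1603535621248) (split 4
  31232 (leaf 5896932026) (link 4 3 (leaf 2671420672) (leaf 23083918336)))))) (split 7 360448 (split
  5 86016 (leaf 5864714840064) (split 16 3102 (leaf 278299761322) (link 11 5 (leaf 8229312256) (leaf
  1438583466)))) (split 4 966656 (split 17 74278 (leaf 213328498524058) (gap)) (split 7 513 (split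
  16 448 (leaf 506718104234) (split 5 45056 (leaf 5731757824) (split 0 962816 (leaf 4356864385365)
  (gap)))) (split 3 98336 (split 15 1152 (leaf 1471809802432) (link 9 4 (leaf 44960032816) (leaf
  366878118960))) (split 3 49168 (split 13 84 (leaf 1604998912) (split 14 8330 (split 0 924032 (leaf
  1219696268039200) (gap)) (split 0 240768 (leaf 307631906444736) (gap)))) (split 0 121600 (leaf
  304876679134528) (gap))))))))) (split 1 532736 (split 4 6471680 (split 13 9437232 (leaf
  38515074572441) (split 11 6430976 (leaf 42880584799520) (split 0 8011776 (leaf 99079091587979008)
  (gap)))) (split 12 3407920 (split 18 33614 (leaf 17167430378340437) (gap)) (split 16 131120 (split
  16 8476 (leaf 4191181931114) (split 17 6408 (leaf 1082375105194) (link 10 4 (leaf 8223741184)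
  (leaf 5904007850)))) (split 17 45056 (split 14 668 (leaf 1095277827242) (split 10 131936 (leaf
  475621582912) (link 10 3 (leaf 1872319232) (leaf 24314772480)))) (split 13 104 (split 7 180224
  (leaf 327220112042) (split 12 528 (leaf 5769996544) (split 0 935552 (leaf 457790190933) (gap))))
  (split 10 114688 (split 6 164864 (leaf 1466478602432) (link 10 3 (leaf 45781056880) (leaf
  372248892720))) (split 10 57344 (split 5 10244 (leaf 1588425984) (split 12 2594 (split 0 917936
  (leaf 1243179094721904) (gap)) (split 0 231840 (leaf 304973466469632) (gap)))) (split 0 115552
  (leaf 304942445791744) (gap))))))))) (split 9 344064 (split 1 7077920 (split 4 25190656 (leaf
  39022606425425) (split 2 6586400 (leaf 23823095256332) (split 0 7864480 (leaf 94950124077186428)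
  (gap)))) (split 3 3151936 (split 6 1265152 (leaf 7432974954921845) (gap)) (split 6 196616 (split 4
  85504 (leaf 91582624682) (split 5 6208 (leaf 369275112106) (split 2 134176 (leaf 389485253888)
  (link 7 2 (leaf 2055935296) (leaf 24343479616))))) (split 4 1568 (split 6 149248 (leaf
  1095260984746) (link 9 3 (leaf 4741715392) (leaf 17001250986))) (split 15 129 (split 11 458752
  (leaf 841640223914) (split 3 1056 (leaf 6352541632) (split 0 996352 (leaf 29302078132245) (gap))))
  (split 1 65560 (split 12 73728 (leaf 1643807266048) (link 9 2 (leaf 20044453184) (leaf
  377867146560))) (split 1 32780 (split 10 129 (leaf 1455033712) (split 2 33858 (split 0 945152
  (leaf 1217891843265856) (gap)) (split 0 252416 (leaf 304161670305276) (gap)))) (split 0 126208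
  (leaf 304372469334676) (gap))))))))) (split 6 2176 (split 15 2208 (split 0 2103552 (leaf
  2080807509) (split 12 3584 (leaf 23982046860) (split 13 17920 (split 10 98312 (leaf 226449578)
  (leaf 2776571)) (split 12 376832 (leaf 68784200029) (split 9 57344 (leaf 722621273429) (leaf
  2822661469)))))) (split 8 65720 (split 14 1051552 (leaf 756624488298) (split 0 622592 (leaf
  2685793941) (split 15 143616 (leaf 16424916904362) (gap)))) (split 11 90112 (split 12 134670
  (split 6 266782 (leaf 1759401867733674) (gap)) (split 9 57344 (leaf 265644778) (link 6 4 (leaf
  95571372714) (leaf 8412204202)))) (split 0 115328 (leaf 635701189290) (split 9 3072 (split 12
  33432 (leaf 24919452552) (split 0 115328 (leaf 1830260571473) (gap))) (split 8 1536 (leaf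
  5997830192) (split 0 15360 (leaf 6849280349) (gap)))))))) (split 7 5120 (split 6 16916 (split 0
  1115648 (leaf 671448725) (split 5 114688 (leaf 23080150272) (split 11 224 (split 3 12416 (leaf
  5726184191) (link 15 8 (leaf 233477126) (leaf 3936305173))) (split 12 65632 (leaf 134883248810)
  (split 12 31 (leaf 68305644266) (gap)))))) (split 11 1284 (split 11 1584 (leaf 821043553368)
  (split 2 286976 (leaf 23569584346368) (split 4 164864 (leaf 5874087269384) (split 0 98336 (leaf
  1035837781) (split 13 581 (leaf 15751602537) (gap)))))) (split 9 57344 (split 13 192 (leaf
  22933013050) (split 14 2432 (leaf 23570684554) (leaf 402066106))) (link 10 2 (leaf 91804837888)
  (leaf 16734906))))) (split 10 10240 (split 3 131392 (split 4 246784 (leaf 1626272690192) (split 9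
  2432 (split 2 65592 (leaf 3129053009) (leaf 7244928512)) (split 2 65616 (leaf 390489527344) (split
  11 44 (leaf 47177335381) (split 11 263 (leaf 11797801301) (gap)))))) (split 3 13312 (split 0
  917600 (leaf 93061862448) (split 6 57344 (leaf 6418027968) (split 4 259 (leaf 23269659648) (split
  3 6912 (leaf 1073383760) (split 7 4098 (leaf 10400134141) (gap)))))) (split 11 1408 (split 9
  442368 (leaf 23909763126624) (link 10 2 (leaf 375077383104) (leaf 7918715578))) (split 3 24592
  (split 15 16906 (split 2 237568 (leaf 387284292656) (leaf 2815232597)) (leaf 25590409920)) (leaf
  368982592))))) (split 2 20512 (split 1 446464 (split 5 3072 (leaf 68135261) (leaf 377597615920))
  (split 9 68608 (split 12 240 (leaf 382161933776) (leaf 376604416512)) (split 0 251904 (leaf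
  1218235955773184) (gap)))) (split 10 5 (split 0 202752 (split 11 393248 (leaf 33187925) (split 3
  524448 (split 5 114688 (leaf 2680121107797) (leaf 6507563678912)) (leaf 68562518101))) (split 3
  4112 (split 14 1600 (leaf 6357850628) (split 4 41344 (leaf 15026765909) (split 2 800 (leaf
  870976084) (leaf 1596624240)))) (split 1 24 (split 8 24584 (leaf 1586054640) (split 4 13824 (leaf
  4272537685) (split 0 63488 (leaf 1172872790908) (gap)))) (split 1 11268 (split 2 65539 (split 9
  24600 (leaf 687962877) (leaf 1336595776)) (leaf 5162494274)) (leaf 100444180))))) (split 2 4384
  (split 11 769 (split 12 771 (leaf 7896575978) (gap)) (split 4 3072 (leaf 11745012053) (split 5 7
  (link 11 9 (leaf 111740412) (leaf 23267858432)) (split 9 131 (leaf 1098801281034) (gap))))) (split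
  6 2816 (split 10 56 (leaf 23599777136) (link 3 2 (leaf 90461197576) (leaf 5900678560))) (split 1
  1104 (split 11 3 (split 1 28672 (leaf 1454306624) (leaf 346756412)) (split 5 6144 (leaf
  1454355776) (split 0 31744 (leaf 1187715022476) (gap)))) (leaf 1566800))))))))))))

triangleRows : List Row
triangleRows = (true ∷ false ∷ true ∷ true ∷ []) ∷ (false ∷ false ∷ false ∷ []) ∷ (true ∷ true ∷ [])
  ∷ (true ∷ []) ∷ ([]) ∷ []

triangleCert : Cert
triangleCert = link 5 3 (found 6 5 4 0 1 2) (link 8 2 (found 0 6 4 1 3 2) (link 10 8 (found 5 6 4 0
  1 2) (link 7 3 (found 1 5 4 0 3 2) (split 7 28672 (split 3 11264 (found 2 6 5 1 3 0) (split 0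
  462920 (leaf 149279811886471116) (gap))) (split 2 14336 (split 0 465408 (leaf 149279669349957260)
  (gap)) (split 0 6688 (leaf 2147330725) (gap)))))))

pentagon₃Rows : List Row
pentagon₃Rows = (true ∷ false ∷ true ∷ true ∷ false ∷ true ∷ []) ∷ (false ∷ false ∷ false ∷ false ∷
  false ∷ []) ∷ (true ∷ false ∷ false ∷ true ∷ []) ∷ (true ∷ false ∷ false ∷ []) ∷ (true ∷ false ∷
  []) ∷ (true ∷ []) ∷ ([]) ∷ []

pentagon₃Cert : Cert
pentagon₃Cert = split 19 184640 (split 18 1048968 (found 5 6 2 0 4 1) (split 16 397332 (found 6 7 1
  5 2 0) (split 15 2490368 (found 6 7 1 5 2 0) (split 15 528128 (found 5 6 2 0 4 1) (leaf
  141191452661))))) (split 9 201654272 (split 19 33593352 (found 5 6 2 0 4 1) (split 0 58839040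
  (found 0 8 7 6 5 4) (split 11 524288 (found 1 8 4 5 6 0) (split 15 14708736 (leaf 24338012077908)
  (split 0 2623552 (found 5 6 2 0 4 1) (split 2 212992 (leaf 12234628675648128) (split 0 1704512
  (leaf 27694031285157) (split 0 65864 (leaf 7856127656) (split 6 17 (found 1 8 4 5 6 0) (leaf
  11636215744)))))))))) (split 20 109051904 (split 10 43450368 (leaf 15819842471688870) (split 13
  10747904 (found 2 6 5 1 3 0) (split 10 4514 (leaf 54151465384602) (split 9 1105936 (found 1 5 4 0
  3 2) (split 7 3932672 (leaf 55386660497697434) (gap)))))) (split 11 50495488 (split 2 2752512
  (found 2 8 1 6 5 0) (split 14 3673600 (leaf 3457552387598169) (leaf 8755275609))) (split 17
  16795648 (split 4 1152 (found 1 7 6 2 3 0) (split 1 2162816 (found 6 7 1 2 5 0) (split 6 787968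
  (leaf 14688080390) (split 4 1966848 (leaf 33344866345354656) (gap))))) (split 0 13631488 (found 0
  7 6 5 4 3) (split 10 769 (split 1 6422528 (split 3 184320 (leaf 190616367706154) (split 2 9216
  (found 9 8 1 5 2 0) (leaf 10693288096))) (split 1 224 (leaf 2858143700) (split 8 589824 (leaf
  961366503978) (split 12 803840 (leaf 119560342570) (split 13 49152 (leaf 46617517309951)
  (gap)))))) (split 5 3407872 (split 2 1314944 (leaf 209274278511274) (split 1 337920 (found 2 8 1 5
  6 0) (split 4 394244 (leaf 7080863970221035) (gap)))) (split 3 1703936 (split 0 657024 (found 2 8
  1 5 6 0) (leaf 796290482362)) (split 4 51200 (split 1 296960 (leaf 3757480576) (split 6 434176
  (leaf 3189372681920) (split 3 139782 (leaf 395210386006) (split 7 16896 (split 0 105600 (found 0 9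
  8 7 6 1) (split 1 12544 (found 9 8 2 1 3 0) (leaf 226445984))) (split 6 8448 (leaf 463314780240)
  (gap)))))) (link 11 0 (found 0 8 7 6 5 1) (split 0 393984 (split 1 205824 (found 6 7 1 5 2 0)
  (leaf 16620066056)) (split 3 132384 (split 0 24576 (found 2 8 1 5 6 0) (split 2 1967520 (leaf
  207940485797097125) (gap))) (split 3 98944 (leaf 217812827503) (gap))))))))))))))

pentagon₄Rows : List Row
pentagon₄Rows = (true ∷ false ∷ true ∷ true ∷ true ∷ true ∷ []) ∷ (false ∷ false ∷ false ∷ false ∷
  false ∷ []) ∷ (true ∷ false ∷ false ∷ true ∷ []) ∷ (true ∷ false ∷ false ∷ []) ∷ (true ∷ false ∷
  []) ∷ (true ∷ []) ∷ ([]) ∷ []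

pentagon₄Cert : Cert
pentagon₄Cert = split 12 2097152 (found 1 7 6 5 4 0) (link 14 5 (found 7 8 2 6 1 0) (link 14 4
  (found 7 8 2 6 1 0) (link 6 3 (found 6 7 2 5 1 0) (link 7 3 (found 6 7 2 5 1 0) (link 13 4 (found
  7 8 2 6 1 0) (link 13 5 (found 7 8 2 6 1 0) (split 9 753664 (leaf 284955321838054058) (link 10 0
  (found 0 8 7 6 5 4) (link 13 6 (found 6 7 2 5 0 1) (split 8 3279872 (leaf 2045927763718058) (link
  6 4 (leaf 44391867) (leaf 31519993514))))))))))))

twoEdgesRows : List Row
twoEdgesRows = (true ∷ false ∷ false ∷ []) ∷ (false ∷ false ∷ []) ∷ (true ∷ []) ∷ ([]) ∷ []

twoEdgesCert : Cert
twoEdgesCert = pent 3 2 1 0 (many ((many ((many ((pent 4 3 6 5 (many ((many ((many ((pent 5 6 8 9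
  (many ((many ((many ((leaf 19982474479034258435) ∷ (leaf 78039091644028330) ∷ (leaf
  78041897778371242) ∷ [])) ∷ [])) ∷ (many ((many ((leaf 1532324574460996181) ∷ (leaf
  12249884902708015125) ∷ [])) ∷ (many ((leaf 2920933579349) ∷ (leaf 730169169045) ∷ [])) ∷ [])) ∷
  (many ((many ((leaf 1385816349029) ∷ [])) ∷ (many ((leaf 78039097682733058) ∷ (leaf
  1219368494967298) ∷ (leaf 23133868103337) ∷ [])) ∷ [])) ∷ (many ((many ((leaf 78041949586199722) ∷
  (leaf 23134667949481) ∷ (leaf 609868672485953) ∷ (leaf 4880362970810688) ∷ [])) ∷ [])) ∷ (many
  ((many ((leaf 12249884784261244245) ∷ (leaf 100744202608379126890880) ∷ [])) ∷ (many ((leaf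
  730166286933) ∷ (leaf 6004891126857984) ∷ [])) ∷ [])) ∷ (many ((many ((leaf 372276311392544) ∷
  [])) ∷ (many ((leaf 4880362903753728) ∷ (leaf 5091471813511488) ∷ [])) ∷ [])) ∷ (many ((many
  ((leaf 329371398917458946836632489586040012888000) ∷ [])) ∷ (many ((leaf
  1980994566068954896362686826643392) ∷ [])) ∷ (many ((leaf 1985985940307427318406798242768552) ∷
  [])) ∷ (many ((leaf 20955107736443278686421372) ∷ [])) ∷ (many ((leaf
  199178612104363195910652667080362294858752) ∷ [])) ∷ [])) ∷ (many ((many ([])) ∷ (many ([])) ∷
  [])) ∷ (many ((many ((leaf 2468198953480676498935637) ∷ [])) ∷ (many ((leaf 4707763148370870442) ∷
  [])) ∷ (many ((leaf 4707763165539733525) ∷ [])) ∷ (many ((leaf 4597426006688773) ∷ [])) ∷ (many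
  ((leaf 20463684161971895979944) ∷ [])) ∷ [])) ∷ []))) ∷ (pent 3 7 8 9 (many ((many ([])) ∷ (many
  ((many ([])) ∷ [])) ∷ (many ((many ([])) ∷ [])) ∷ (many ((many ([])) ∷ [])) ∷ (many ((many ((leaf
  55751877174758511761790403420509279903634773) ∷ [])) ∷ (many ([])) ∷ (many ((leaf
  2021534255143667869108173945033462952) ∷ [])) ∷ (many ((leaf
  55751877174758511772670735797041148634420565) ∷ [])) ∷ [])) ∷ (many ((many ([])) ∷ [])) ∷ (many
  ((many ([])) ∷ (many ([])) ∷ (many ([])) ∷ [])) ∷ []))) ∷ (pent 5 6 8 9 (many ((many ([])) ∷ (many
  ((many ([])) ∷ [])) ∷ (many ((many ([])) ∷ [])) ∷ (many ((many ([])) ∷ [])) ∷ (many ((many ((leaf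
  56332611569150874233184722783646363153684096) ∷ [])) ∷ (many ([])) ∷ (many ((leaf
  2054418783757935444730799610455401108) ∷ [])) ∷ (many ((leaf
  56332611569150874234317727028829193038555136) ∷ [])) ∷ [])) ∷ (many ((many ([])) ∷ [])) ∷ (many
  ((many ([])) ∷ (many ([])) ∷ (many ([])) ∷ [])) ∷ []))) ∷ (leaf 23410658083021151948241578) ∷ []))
  ∷ [])) ∷ (many ((many ((pent 3 7 8 9 (many ((many ((many ([])) ∷ [])) ∷ (many ((many ([])) ∷ []))
  ∷ (many ((many ((leaf 55751877174758511144032304141449053797874623) ∷ [])) ∷ (many ((leaf
  2021534250211248459049117905375936496) ∷ [])) ∷ (many ((leaf
  55751877174758511158539413976825222369636335) ∷ [])) ∷ [])) ∷ (many ((many ([])) ∷ [])) ∷ []))) ∷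
  (leaf 6441311158250858586917546) ∷ (leaf 54401267967810905165270696) ∷ [])) ∷ [])) ∷ (many ((many
  ((pent 5 6 2 8 (many ((many ([])) ∷ (many ([])) ∷ (many ([])) ∷ (many ((many ((leaf
  56687649483557041936613638720183632) ∷ [])) ∷ (many ([])) ∷ [])) ∷ (many ((many ([])) ∷ [])) ∷
  (many ((many ([])) ∷ [])) ∷ (many ((many ([])) ∷ (many ([])) ∷ (many ([])) ∷ (many ([])) ∷ (many
  ([])) ∷ (many ([])) ∷ [])) ∷ (many ((many ((leaf 20934027647982242726900479385089517730) ∷ [])) ∷
  (many ((leaf 109017875859955742004844461468069) ∷ [])) ∷ (many ((leaf
  109017875859956552652777388157349) ∷ [])) ∷ (many ((leaf 486777754728207641107980037548453) ∷ []))
  ∷ (many ((leaf 29037432105454441879300013095474400591091) ∷ [])) ∷ (many ([])) ∷ [])) ∷ []))) ∷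
  [])) ∷ (many ((leaf 403173125346637666146986) ∷ [])) ∷ [])) ∷ (many ((many ((pent 5 6 8 9 (many
  ((many ((many ([])) ∷ [])) ∷ (many ((many ([])) ∷ [])) ∷ (many ((many ((leaf
  56332611569150873459497390006572590433024000) ∷ [])) ∷ (many ((leaf
  2049246769309002867190930352243733829) ∷ [])) ∷ (many ((leaf
  56332611569150873461008547596342915174727680) ∷ [])) ∷ [])) ∷ (many ((many ([])) ∷ [])) ∷ []))) ∷
  (leaf 68908377803186455261806208) ∷ (leaf 11281734679746463819715882) ∷ [])) ∷ [])) ∷ (many ((many
  ((leaf 975267061347644400990890) ∷ [])) ∷ (many ((leaf 43519753846737020842463138) ∷ (split 0 0
  (leaf 238240595843170487620) (split 15 0 (leaf 53887444686989164544) (leaf 36827507207757283330)))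
  ∷ [])) ∷ [])) ∷ []))) ∷ [])) ∷ [])) ∷ []))

-- The certificate of the wheel must not call on `found`; the three certificates that may do so are
-- checked with `wheels` switched on, after wheels are settled.
wheelRules noWheelRules noTriangleRules : Rules
wheelRules    = record { p = 0 ; r = 2 ; wheels = false ; pentas = false }
noWheelRules    = record { p = 0 ; r = 2 ; wheels = true  ; pentas = false }
noTriangleRules = record { p = 1 ; r = 1 ; wheels = false ; pentas = true }

triangle-checks : Check.check noWheelRules triangleCert (Check.build noWheelRules triangleRows) ≡ true
triangle-checks = refl

pentagon₄-checks : Check.check noWheelRules pentagon₄Cert (Check.build noWheelRules pentagon₄Rows) ≡ true
pentagon₄-checks = refl

pentagon₃-checks : Check.check noWheelRules pentagon₃Cert (Check.build noWheelRules pentagon₃Rows) ≡ true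
pentagon₃-checks = refl

wheel-checks : Check.check wheelRules wheelCert (Check.build wheelRules wheelRows) ≡ true
wheel-checks = refl

twoEdges-checks : Check.check noTriangleRules twoEdgesCert (Check.build noTriangleRules twoEdgesRows) ≡ true
twoEdges-checks = refl

-- Partial colourings

module Partial {n} (G : Graph n) where

  ColourableOn : (Fin n → Bool) → ℕ → Set
  ColourableOn S k = Σ (Fin n → Fin k) λ c →
    ∀ u v → S u ≡ true → S v ≡ true → adj G u v ≡ true → c u ≡ c v → ⊥

  stable-colourable : ∀ {S k} → (∀ u v → S u ≡ true → S v ≡ true → adj G u v ≡ true → ⊥) →
    ColourableOn S (suc k)
  stable-colourable h = (λ _ → zero) , λ u v su sv uv _ → h u v su sv uv

  ↑ˡ≢↑ʳ : ∀ {a b} (i : Fin a) (j : Fin b) → i ↑ˡ b ≡ a ↑ʳ j → ⊥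
  ↑ˡ≢↑ʳ {a} {b} i j e
    with () ← trans (≡-sym (splitAt-↑ˡ a i b)) (trans (cong (splitAt a) e) (splitAt-↑ʳ a b j))

  join : ∀ {S T a b} → ColourableOn S a → ColourableOn T b → ColourableOn (λ v → S v ∨ T v) (a + b)
  join {S} {T} {a} {b} (c , pc) (d , pd) = colour , proper
    where
    colour : Fin n → Fin (a + b)
    colour v = if S v then c v ↑ˡ b else a ↑ʳ d v
    proper : ∀ u v → S u ∨ T u ≡ true → S v ∨ T v ≡ true → adj G u v ≡ true → colour u ≡ colour v → ⊥
    proper u v su sv uv e with S u in equ | S v in eqv
    ... | true  | true  = pc u v equ eqv uv (↑ˡ-injective b _ _ e)
    ... | true  | false = ↑ˡ≢↑ʳ _ _ e
    ... | false | true  = ↑ˡ≢↑ʳ _ _ (≡-sym e)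
    ... | false | false = pd u v su sv uv (↑ʳ-injective a _ _ e)

  covering : ∀ {S k} → (∀ v → S v ≡ true) → ColourableOn S k → Colourable G k
  covering h (c , pc) = c , λ u v → pc u v (h u) (h v)

  Matching? : ∀ k S → Dec (Matching G k S)
  Matching? zero    S = yes tt
  Matching? (suc k) S = any? λ a → any? λ b →
    ((S a ≟ᵇ true) ×-dec ((S b ≟ᵇ true) ×-dec (adj G a b ≟ᵇ true))) ×-dec Matching? k _

  Clique? : ∀ k S → Dec (Clique G k S)
  Clique? zero    S = yes tt
  Clique? (suc k) S = any? λ a → (S a ≟ᵇ true) ×-dec Clique? k _

  triangle-in : ∀ {S a b c} → S a ≡ true → S b ≡ true → S c ≡ true →
    adj G a b ≡ true → adj G a c ≡ true → adj G b c ≡ true → Clique G 3 S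
  triangle-in sa sb sc ab ac bc = _ , sa , _ , ∧-intro sb ab , _ , ∧-intro (∧-intro sc ac) bc , tt

  matching-in : ∀ {S a b c d} → S a ≡ true → S b ≡ true → S c ≡ true → S d ≡ true →
    Matching₂ G a b c d → Matching G 2 S
  matching-in sa sb sc sd (matching✓ ab cd ac ad bc bd) = _ , _ , (sa , sb , ab) , _ , _ ,
    (∧-intro (∧-intro sc (not-intro ac)) (not-intro bc) , ∧-intro (∧-intro sd (not-intro ad)) (not-intro bd) , cd) , tt

  PentagonThrough : (Fin n → Bool) → Fin n → Fin n → Set
  PentagonThrough S c d = ∃ λ x → ∃ λ y → ∃ λ z →
    Pentagon G c d x y z × S x ≡ true × S y ≡ true × S z ≡ true

  -- The neighbours of c take colour 0 and those of d colour 1; both sets are stable for want of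
  -- triangles. The other vertices form a stable set, as an edge among them would make 2K₂ with cd,
  -- and each takes colour 1 exactly if it is adjacent to some neighbour z of c. The one possible
  -- conflict is then between a neighbour x of d and such a vertex y, and it closes the pentagon c d
  -- x y z.
  bipartite-or-pentagon : ∀ S → (Matching G 2 S → ⊥) → (Clique G 3 S → ⊥) →
    ∀ c d → S c ≡ true → S d ≡ true → adj G c d ≡ true → ColourableOn S 2 ⊎ PentagonThrough S c d
  bipartite-or-pentagon S noM noC c d sc sd cd
    -- Two non-edges suffice in the search: the other three of the pentagon follow from the absence
    -- of triangles.
    with any? (λ x → any? λ y → any? λ z →
           ((S x ≟ᵇ true) ×-dec ((S y ≟ᵇ true) ×-dec (S z ≟ᵇ true))) ×-dec
           ((adj G d x ≟ᵇ true) ×-dec ((adj G x y ≟ᵇ true) ×-dec ((adj G y z ≟ᵇ true) ×-dec (adj G z c ≟ᵇ true)))) ×-dec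
           ((adj G y c ≟ᵇ false) ×-dec (adj G y d ≟ᵇ false)))
  ... | yes (x , y , z , (sx , sy , sz) , (dx , xy , yz , zc) , (yc , yd)) =
    inj₂ (x , y , z , pentagon✓ cd dx xy yz zc
      (refute λ cx → noC (triangle-in sc sd sx cd cx dx)) (adj-swap G yd)
      (refute λ xz → noC (triangle-in sx sy sz xy xz yz)) yc
      (refute λ zd → noC (triangle-in sz sc sd zc zd cd)) , sx , sy , sz)
  ... | no none = inj₁ ((λ v → colour (kind v)) , λ u v → proper u v (kind u) (kind v))
    where
    LinkedToC : Fin n → Set
    LinkedToC v = ∃ λ z → S z ≡ true × adj G v z ≡ true × adj G z c ≡ true

    data Kind (v : Fin n) : Set where
      nearC    : adj G v c ≡ true → Kind v
      nearD    : adj G v d ≡ true → Kind v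
      linked   : adj G v c ≡ false → adj G v d ≡ false → LinkedToC v → Kind v
      unlinked : adj G v c ≡ false → adj G v d ≡ false → ¬ LinkedToC v → Kind v

    kind : ∀ v → Kind v
    kind v with true-or-false (adj G v c) | true-or-false (adj G v d)
    ... | inj₁ vc | _       = nearC vc
    ... | inj₂ _  | inj₁ vd = nearD vd
    ... | inj₂ vc | inj₂ vd
      with any? (λ z → (S z ≟ᵇ true) ×-dec ((adj G v z ≟ᵇ true) ×-dec (adj G z c ≟ᵇ true)))
    ...   | yes l = linked vc vd l
    ...   | no ¬l = unlinked vc vd ¬l

    colour : ∀ {v} → Kind v → Fin 2
    colour (nearC _)        = zero
    colour (nearD _)        = suc zero
    colour (linked _ _ _)   = suc zero
    colour (unlinked _ _ _) = zero

    apart-from-cd : ∀ u v → S u ≡ true → S v ≡ true → adj G u v ≡ true →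
      adj G u c ≡ false → adj G u d ≡ false → adj G v c ≡ false → adj G v d ≡ false → ⊥
    apart-from-cd u v su sv uv uc ud vc vd = noM (matching-in su sv sc sd (matching✓ uv cd uc ud vc vd))

    proper : ∀ u v (ku : Kind u) (kv : Kind v) → S u ≡ true → S v ≡ true → adj G u v ≡ true →
             colour ku ≡ colour kv → ⊥
    proper u v (nearC uc) (nearC vc) su sv uv _ = noC (triangle-in su sv sc uv uc vc)
    proper u v (nearD ud) (nearD vd) su sv uv _ = noC (triangle-in su sv sd uv ud vd)
    proper u v (nearC uc) (unlinked _ _ ¬l) su sv uv _ = ¬l (u , su , adj-swap G uv , uc)
    proper u v (unlinked _ _ ¬l) (nearC vc) su sv uv _ = ¬l (v , sv , uv , vc)
    proper u v (nearD ud) (linked vc vd (z , sz , vz , zc)) su sv uv _ =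
      none (u , v , z , (su , sv , sz) , (adj-swap G ud , uv , vz , zc) , (vc , vd))
    proper u v (linked uc ud (z , sz , uz , zc)) (nearD vd) su sv uv _ =
      none (v , u , z , (sv , su , sz) , (adj-swap G vd , adj-swap G uv , uz , zc) , (uc , ud))
    proper u v (linked uc ud _) (linked vc vd _) su sv uv _ = apart-from-cd u v su sv uv uc ud vc vd
    proper u v (unlinked uc ud _) (unlinked vc vd _) su sv uv _ = apart-from-cd u v su sv uv uc ud vc vd
    proper u v (nearC _) (nearD _) su sv uv ()
    proper u v (nearC _) (linked _ _ _) su sv uv ()
    proper u v (nearD _) (nearC _) su sv uv ()
    proper u v (nearD _) (unlinked _ _ _) su sv uv ()
    proper u v (linked _ _ _) (nearC _) su sv uv ()
    proper u v (linked _ _ _) (unlinked _ _ _) su sv uv ()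
    proper u v (unlinked _ _ _) (nearD _) su sv uv ()
    proper u v (unlinked _ _ _) (linked _ _ _) su sv uv ()

  bipartite-or-some-pentagon : ∀ S → (Matching G 2 S → ⊥) → (Clique G 3 S → ⊥) →
    ColourableOn S 2 ⊎ (∃ λ c → ∃ λ d → S c ≡ true × S d ≡ true × PentagonThrough S c d)
  bipartite-or-some-pentagon S noM noC with Matching? 1 S
  ... | no none = inj₁ (stable-colourable λ u v su sv uv → none (u , v , (su , sv , uv) , tt))
  ... | yes (c , d , (sc , sd , cd) , _) with bipartite-or-pentagon S noM noC c d sc sd cd
  ...   | inj₁ col = inj₁ col
  ...   | inj₂ pen = inj₂ (c , d , sc , sd , pen)

-- The two exceptional bounds

rotate : ∀ {n} {G : Graph n} {a b c d e} → Pentagon G a b c d e → Pentagon G b c d e a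
rotate (pentagon✓ ab bc cd de ea ac bd ce da eb) = pentagon✓ bc cd de ea ab bd ce da eb ac

infixr 5 _∷≡_
_∷≡_ : ∀ {x y : Bool} {s t : Row} → x ≡ y → s ≡ t → x ∷ s ≡ y ∷ t
_∷≡_ = cong₂ _∷_

module Without2K₂K₄ {n} (G : Graph n)
  (noM : Matching G 2 (everything G) → ⊥) (noC : Clique G 4 (everything G) → ⊥) where
  open Partial G

  private
    ↔ : ∀ {x y b} → adj G x y ≡ b → adj G y x ≡ b
    ↔ = adj-swap G

  wheel-colourable : ∀ h a b c d e → Wheel G h a b c d e → Colourable G 4
  wheel-colourable h a b c d e (wheel✓ (pentagon✓ ab bc cd de ea ac bd ce da eb) ha hb hc hd he) =
    certified wheelRows wheelCert (h ∷ e ∷ d ∷ c ∷ b ∷ a ∷ [])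
      ( he ∷≡ hd ∷≡ hc ∷≡ hb ∷≡ ha ∷≡ refl
      , ↔ de ∷≡ ↔ ce ∷≡ eb ∷≡ ea ∷≡ refl
      , ↔ cd ∷≡ ↔ bd ∷≡ da ∷≡ refl
      , ↔ bc ∷≡ ↔ ac ∷≡ refl
      , ↔ ab ∷≡ refl
      , refl , tt) wheel-checks
    where open Soundness G wheelRules noM noC (λ ()) (λ ())

  open Soundness G noWheelRules noM noC (λ _ → wheel-colourable) (λ ())

  module _ (u v : Fin n) (uv : adj G u v ≡ true) where

    -- The edges uv and xy cannot form 2K₂, and v sees neither end of xy.
    touches : ∀ {x y} → adj G v x ≡ false → adj G v y ≡ false → adj G x y ≡ true → adj G u x ≡ false → adj G u y ≡ true
    touches vx vy xy ux = affirm λ uy → noM (matching-in refl refl refl refl (matching✓ uv xy ux uy vx vy))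

    triangle-colourable : ∀ a b c → adj G a b ≡ true → adj G a c ≡ true → adj G b c ≡ true →
      adj G v a ≡ false → adj G v b ≡ false → adj G v c ≡ false →
      adj G u a ≡ true → adj G u b ≡ true → adj G u c ≡ false → Colourable G 4
    triangle-colourable a b c ab ac bc va vb vc ua ub uc =
      certified triangleRows triangleCert (u ∷ v ∷ c ∷ b ∷ a ∷ [])
        ( uv ∷≡ uc ∷≡ ub ∷≡ ua ∷≡ refl
        , vc ∷≡ vb ∷≡ va ∷≡ refl
        , ↔ bc ∷≡ ↔ ac ∷≡ refl
        , ↔ ab ∷≡ refl
        , refl , tt) triangle-checks

    pentagon₃-colourable : ∀ a b c d e → Pentagon G a b c d e →
      adj G v a ≡ false → adj G v b ≡ false → adj G v c ≡ false → adj G v d ≡ false → adj G v e ≡ false →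
      adj G u a ≡ true → adj G u b ≡ false → adj G u c ≡ true → adj G u d ≡ true → adj G u e ≡ false → Colourable G 4
    pentagon₃-colourable a b c d e (pentagon✓ ab bc cd de ea ac bd ce da eb) va vb vc vd ve ua ub uc ud ue =
      certified pentagon₃Rows pentagon₃Cert (u ∷ v ∷ e ∷ d ∷ c ∷ b ∷ a ∷ [])
        ( uv ∷≡ ue ∷≡ ud ∷≡ uc ∷≡ ub ∷≡ ua ∷≡ refl
        , ve ∷≡ vd ∷≡ vc ∷≡ vb ∷≡ va ∷≡ refl
        , ↔ de ∷≡ ↔ ce ∷≡ eb ∷≡ ea ∷≡ refl
        , ↔ cd ∷≡ ↔ bd ∷≡ da ∷≡ refl
        , ↔ bc ∷≡ ↔ ac ∷≡ refl
        , ↔ ab ∷≡ refl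
        , refl , tt) pentagon₃-checks

    pentagon₄-colourable : ∀ a b c d e → Pentagon G a b c d e →
      adj G v a ≡ false → adj G v b ≡ false → adj G v c ≡ false → adj G v d ≡ false → adj G v e ≡ false →
      adj G u a ≡ true → adj G u b ≡ true → adj G u c ≡ true → adj G u d ≡ true → adj G u e ≡ false → Colourable G 4
    pentagon₄-colourable a b c d e (pentagon✓ ab bc cd de ea ac bd ce da eb) va vb vc vd ve ua ub uc ud ue =
      certified pentagon₄Rows pentagon₄Cert (u ∷ v ∷ e ∷ d ∷ c ∷ b ∷ a ∷ [])
        ( uv ∷≡ ue ∷≡ ud ∷≡ uc ∷≡ ub ∷≡ ua ∷≡ refl
        , ve ∷≡ vd ∷≡ vc ∷≡ vb ∷≡ va ∷≡ refl
        , ↔ de ∷≡ ↔ ce ∷≡ eb ∷≡ ea ∷≡ refl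
        , ↔ cd ∷≡ ↔ bd ∷≡ da ∷≡ refl
        , ↔ bc ∷≡ ↔ ac ∷≡ refl
        , ↔ ab ∷≡ refl
        , refl , tt) pentagon₄-checks

    -- By `touches` the vertices of the pentagon that u misses are pairwise non-consecutive. Besides
    -- b this leaves at most one of d and e, and the rotation brings each case to the labelling of
    -- its certificate.
    missing-b-colourable : ∀ a b c d e → Pentagon G a b c d e →
      adj G v a ≡ false → adj G v b ≡ false → adj G v c ≡ false → adj G v d ≡ false → adj G v e ≡ false →
      adj G u b ≡ false → Colourable G 4
    missing-b-colourable a b c d e P@(pentagon✓ ab bc cd de ea ac bd ce da eb) va vb vc vd ve ub
      with touches vb va (↔ ab) ub | touches vb vc bc ub | true-or-false (adj G u d) | true-or-false (adj G u e)
    ... | ua | uc | inj₁ ud | inj₁ ue = pentagon₄-colourable c d e a b (rotate (rotate P)) vc vd ve va vb uc ud ue ua ub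
    ... | ua | uc | inj₁ ud | inj₂ ue = pentagon₃-colourable a b c d e P va vb vc vd ve ua ub uc ud ue
    ... | ua | uc | inj₂ ud | inj₁ ue = pentagon₃-colourable c d e a b (rotate (rotate P)) vc vd ve va vb uc ud ue ua ub
    ... | ua | uc | inj₂ ud | inj₂ ue = true≢false (touches vd ve de ud) ue

    pentagon-colourable : ∀ a b c d e → Pentagon G a b c d e →
      adj G v a ≡ false → adj G v b ≡ false → adj G v c ≡ false → adj G v d ≡ false → adj G v e ≡ false → Colourable G 4
    pentagon-colourable a b c d e P va vb vc vd ve
      with true-or-false (adj G u a) | true-or-false (adj G u b) | true-or-false (adj G u c)
         | true-or-false (adj G u d) | true-or-false (adj G u e)
    ... | inj₁ ua | inj₁ ub | inj₁ uc | inj₁ ud | inj₁ ue = wheel-colourable u a b c d e (wheel✓ P ua ub uc ud ue)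
    ... | inj₂ ua | _ | _ | _ | _ =
      missing-b-colourable e a b c d (rotate (rotate (rotate (rotate P)))) ve va vb vc vd ua
    ... | _ | inj₂ ub | _ | _ | _ = missing-b-colourable a b c d e P va vb vc vd ve ub
    ... | _ | _ | inj₂ uc | _ | _ = missing-b-colourable b c d e a (rotate P) vb vc vd ve va uc
    ... | _ | _ | _ | inj₂ ud | _ = missing-b-colourable c d e a b (rotate (rotate P)) vc vd ve va vb ud
    ... | _ | _ | _ | _ | inj₂ ue = missing-b-colourable d e a b c (rotate (rotate (rotate P))) vd ve va vb vc ue

    neighbours-colourable : Colourable G 4 ⊎ ColourableOn (adj G v) 2
    neighbours-colourable
      with bipartite-or-some-pentagon (adj G v) (λ m → noM (Matching-mono G 2 (λ _ _ → refl) m)) (λ c → noC (v , refl , c))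
    ... | inj₁ col = inj₂ col
    ... | inj₂ (c , d , vc , vd , x , y , z , P , vx , vy , vz) =
      inj₁ (wheel-colourable v c d x y z (wheel✓ P vc vd vx vy vz))

    others-colourable : Colourable G 4 ⊎ ColourableOn (λ w → not (adj G v w)) 2
    others-colourable with Clique? 3 (λ w → not (adj G v w))
    ... | yes (a , na , b , tb , c , tc , _) with ∧-true tb | ∧-true tc
    ...   | nb , ab | tc′ , bc with ∧-true tc′
    ...     | nc , ac = inj₁ on-triangle
      where
      va = not-true na
      vb = not-true nb
      vc = not-true nc
      on-triangle : Colourable G 4
      -- Seeing all three vertices would give K₄, and missing two would contradict `touches`; so u
      -- misses exactly one.
      on-triangle with true-or-false (adj G u a) | true-or-false (adj G u b) | true-or-false (adj G u c)
      ... | inj₁ ua | inj₁ ub | inj₁ uc = ⊥-elim (noC (u , refl , triangle-in ua ub uc ab ac bc))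
      ... | inj₂ ua | _ | _ = triangle-colourable b c a bc (↔ ab) (↔ ac) vb vc va (touches va vb ab ua) (touches va vc ac ua) ua
      ... | _ | inj₂ ub | _ = triangle-colourable a c b ac ab (↔ bc) va vc vb (touches vb va (↔ ab) ub) (touches vb vc bc ub) ub
      ... | _ | _ | inj₂ uc = triangle-colourable a b c ab ac bc va vb vc (touches vc va (↔ ac) uc) (touches vc vb (↔ bc) uc) uc
    others-colourable | no none
      with bipartite-or-some-pentagon (λ w → not (adj G v w)) (λ m → noM (Matching-mono G 2 (λ _ _ → refl) m)) none
    ... | inj₁ col = inj₂ col
    ... | inj₂ (c , d , nc , nd , x , y , z , P , nx , ny , nz) =
      inj₁ (pentagon-colourable c d x y z P (not-true nc) (not-true nd) (not-true nx) (not-true ny) (not-true nz))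

  four-colourable : Colourable G 4
  four-colourable with Matching? 1 (everything G)
  ... | no none = covering {everything G} (λ _ → refl) (stable-colourable λ u v su sv uv → none (u , v , (su , sv , uv) , tt))
  ... | yes (u , v , (_ , _ , uv) , _) with neighbours-colourable u v uv | others-colourable u v uv
  ...   | inj₁ col | _        = col
  ...   | _        | inj₁ col = col
  ...   | inj₂ near | inj₂ far = covering covers (join near far)
    where
    covers : ∀ w → adj G v w ∨ not (adj G v w) ≡ true
    covers w with adj G v w
    ... | true  = refl
    ... | false = refl

module Without3K₂K₃ {n} (G : Graph n)
  (noM : Matching G 3 (everything G) → ⊥) (noC : Clique G 3 (everything G) → ⊥) where
  open Partial G

  private
    ↔ : ∀ {x y b} → adj G x y ≡ b → adj G y x ≡ b
    ↔ = adj-swap G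

  non-neighbours : Fin n → Fin n → Fin n → Bool
  non-neighbours a b v = not (adj G a v) ∧ not (adj G b v)

  from-edge : ∀ a b → ColourableOn (non-neighbours a b) 2 → Colourable G 4
  from-edge a b rest = covering covers (join (join (neighbours a) (neighbours b)) rest)
    where
    neighbours : ∀ x → ColourableOn (adj G x) 1
    neighbours x = stable-colourable λ u v xu xv uv → noC (triangle-in {a = x} refl refl refl xu xv uv)
    covers : ∀ v → (adj G a v ∨ adj G b v) ∨ non-neighbours a b v ≡ true
    covers v with adj G a v | adj G b v
    ... | true  | _     = refl
    ... | false | true  = refl
    ... | false | false = refl

  pentagon-avoiding : ∀ a b c d → Matching₂ G a b c d → Colourable G 4 ⊎ PentagonAvoiding G a b c d
  pentagon-avoiding a b c d (matching✓ ab cd ac ad bc bd)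
    with bipartite-or-pentagon (non-neighbours a b) (λ m → noM (a , b , (refl , refl , ab) , m))
           (λ t → noC (Clique-mono G 3 (λ _ _ → refl) t)) c d
           (∧-intro (not-intro ac) (not-intro bc)) (∧-intro (not-intro ad) (not-intro bd)) cd
  ... | inj₁ col = inj₁ (from-edge a b col)
  ... | inj₂ (x , y , z , P , nx , ny , nz) = inj₂ (x , y , z , P , away nx , away ny , away nz)
    where
    away : ∀ {w} → non-neighbours a b w ≡ true → Avoids G a b w
    away e = avoids (↔ (not-true (proj₁ (∧-true e)))) (↔ (not-true (proj₂ (∧-true e))))

  open Soundness G noTriangleRules noM noC (λ ()) (λ _ → pentagon-avoiding)

  four-colourable : Colourable G 4
  four-colourable with Matching? 2 (everything G)
  ... | yes (a , b , (_ , _ , ab) , c , d , (mc , md , cd) , _) =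
    certified twoEdgesRows twoEdgesCert (d ∷ c ∷ b ∷ a ∷ [])
      ( ↔ cd ∷≡ ↔ (not-true (proj₂ (∧-true md))) ∷≡ ↔ (not-true (proj₁ (∧-true md))) ∷≡ refl
      , ↔ (not-true (proj₂ (∧-true mc))) ∷≡ ↔ (not-true (proj₁ (∧-true mc))) ∷≡ refl
      , ↔ ab ∷≡ refl
      , refl , tt) twoEdges-checks
  ... | no none with Matching? 1 (everything G)
  ...   | no none₁ = covering {everything G} (λ _ → refl) (stable-colourable λ u v su sv uv → none₁ (u , v , (su , sv , uv) , tt))
  ...   | yes (a , b , (_ , _ , ab) , _) = from-edge a b
          (stable-colourable λ u v su sv uv → none (a , b , (refl , refl , ab) , u , v , (su , sv , uv) , tt))

-- Induced subgraphs

≡ᵇ-false : ∀ {m n} → m ≢ n → (m ≡ᵇ n) ≡ false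
≡ᵇ-false {m} {n} h = refute λ e → h (≡ᵇ⇒≡ m n (subst T (≡-sym e) tt))

≡ᵇ-refl : ∀ m → (m ≡ᵇ m) ≡ true
≡ᵇ-refl zero    = refl
≡ᵇ-refl (suc m) = ≡ᵇ-refl m

∨-false⁺ : ∀ {a b} → a ≡ false → b ≡ false → a ∨ b ≡ false
∨-false⁺ refl refl = refl

module _ {n} (G : Graph n) where

  record IndexedMatching (p : ℕ) (ω : Fin n → Bool) : Set where
    field
      a b  : Fin p → Fin n
      ωa   : ∀ i → ω (a i) ≡ true
      ωb   : ∀ i → ω (b i) ≡ true
      edge : ∀ i → adj G (a i) (b i) ≡ true
      aa   : ∀ i j → i ≢ j → adj G (a i) (a j) ≡ false
      ab   : ∀ i j → i ≢ j → adj G (a i) (b j) ≡ false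
      bb   : ∀ i j → i ≢ j → adj G (b i) (b j) ≡ false

  index-matching : ∀ p {ω} → Matching G p ω → IndexedMatching p ω
  index-matching zero m = record
    { a = λ () ; b = λ () ; ωa = λ () ; ωb = λ () ; edge = λ () ; aa = λ () ; ab = λ () ; bb = λ () }
  index-matching (suc p) {ω} (x , y , (ωx , ωy , xy) , m) = record
    { a    = λ { zero → x ; (suc i) → M.a i }
    ; b    = λ { zero → y ; (suc i) → M.b i }
    ; ωa   = λ { zero → ωx ; (suc i) → proj₁ (∧-true (proj₁ (∧-true (M.ωa i)))) }
    ; ωb   = λ { zero → ωy ; (suc i) → proj₁ (∧-true (proj₁ (∧-true (M.ωb i)))) }
    ; edge = λ { zero → xy ; (suc i) → M.edge i }
    ; aa   = λ { zero zero h → ⊥-elim (h refl) ; zero (suc j) h → offx (M.ωa j)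
               ; (suc i) zero h → adj-swap G (offx (M.ωa i)) ; (suc i) (suc j) h → M.aa i j (λ e → h (cong suc e)) }
    ; ab   = λ { zero zero h → ⊥-elim (h refl) ; zero (suc j) h → offx (M.ωb j)
               ; (suc i) zero h → adj-swap G (offy (M.ωa i)) ; (suc i) (suc j) h → M.ab i j (λ e → h (cong suc e)) }
    ; bb   = λ { zero zero h → ⊥-elim (h refl) ; zero (suc j) h → offy (M.ωb j)
               ; (suc i) zero h → adj-swap G (offy (M.ωb i)) ; (suc i) (suc j) h → M.bb i j (λ e → h (cong suc e)) }
    }
    where
    module M = IndexedMatching (index-matching p m)
    offx : ∀ {v} → (ω v ∧ not (adj G x v)) ∧ not (adj G y v) ≡ true → adj G x v ≡ false
    offx {v} e = not-true (proj₂ (∧-true {ω v} (proj₁ (∧-true e))))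
    offy : ∀ {v} → (ω v ∧ not (adj G x v)) ∧ not (adj G y v) ≡ true → adj G y v ≡ false
    offy e = not-true (proj₂ (∧-true e))

  matching⇒induced : ∀ q → Matching G (suc q) (everything G) → InducedIn (pK2 q) G
  matching⇒induced q m = φ , injective , preserves
    where
    open IndexedMatching (index-matching (suc q) m)
    p = suc q

    pick : Fin p ⊎ Fin p → Fin n
    pick (inj₁ i) = a i
    pick (inj₂ i) = b i

    φ : Fin (p + p) → Fin n
    φ i = pick (splitAt p i)

    -- The number of a picked vertex in `pK2`, whose edges join i and p + i; adjacency becomes
    -- arithmetic that `far`, `across` and `beyond` settle case by case.
    value : Fin p ⊎ Fin p → ℕ
    value (inj₁ i) = toℕ i
    value (inj₂ i) = p + toℕ i

    toℕ-value : ∀ i → toℕ i ≡ value (splitAt p i)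
    toℕ-value i with splitAt p i in eq
    ... | inj₁ k = trans (cong toℕ (≡-sym (splitAt⁻¹-↑ˡ eq))) (toℕ-↑ˡ k p)
    ... | inj₂ k = trans (cong toℕ (≡-sym (splitAt⁻¹-↑ʳ eq))) (toℕ-↑ʳ p k)

    -- If two picked vertices coincided, the partner of one would be adjacent to the other, which
    -- the matching or irreflexivity excludes.
    pick-injective : ∀ s t → pick s ≡ pick t → s ≡ t
    pick-injective (inj₁ i) (inj₁ j) e with i ≟ j
    ... | yes refl = refl
    ... | no h = true≢false (subst (λ z → adj G z (b i) ≡ true) e (edge i)) (ab j i (λ x → h (≡-sym x)))
    pick-injective (inj₂ i) (inj₂ j) e with i ≟ j
    ... | yes refl = refl
    ... | no h = true≢false (subst (λ z → adj G (a i) z ≡ true) e (edge i)) (ab i j h)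
    pick-injective (inj₁ i) (inj₂ j) e with i ≟ j
    ... | yes refl = true≢false (subst (λ z → adj G z (b i) ≡ true) e (edge i)) (irrefl G (b i))
    ... | no h = true≢false (subst (λ z → adj G z (b i) ≡ true) e (edge i)) (bb j i (λ x → h (≡-sym x)))
    pick-injective (inj₂ i) (inj₁ j) e with i ≟ j
    ... | yes refl = true≢false (subst (λ z → adj G (a i) z ≡ true) e (edge i)) (irrefl G (a i))
    ... | no h = true≢false (subst (λ z → adj G (a i) z ≡ true) e (edge i)) (aa i j h)

    injective : ∀ {i j} → φ i ≡ φ j → i ≡ j
    injective {i} {j} e = toℕ-injective (trans (toℕ-value i)
      (trans (cong value (pick-injective (splitAt p i) (splitAt p j) e)) (≡-sym (toℕ-value j))))

    far : ∀ x (j : Fin p) → ((x + p) ≡ᵇ toℕ j) ≡ false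
    far x j = ≡ᵇ-false λ e → <⇒≱ (toℕ<n j) (subst (p ≤_) e (m≤n+m p x))

    across : ∀ (i j : Fin p) → i ≢ j → ((toℕ i + p) ≡ᵇ (p + toℕ j)) ≡ false
    across i j h = ≡ᵇ-false λ e →
      h (toℕ-injective (+-cancelˡ-≡ p _ _ (trans (+-comm p (toℕ i)) e)))

    beyond : ∀ (i j : Fin p) → ((p + toℕ i + p) ≡ᵇ (p + toℕ j)) ≡ false
    beyond i j = ≡ᵇ-false λ e → <⇒≱ (toℕ<n j)
      (subst (p ≤_) (+-cancelˡ-≡ p _ _ (trans (≡-sym (+-assoc p (toℕ i) p)) e)) (m≤n+m p (toℕ i)))

    joined? : ℕ → ℕ → Bool
    joined? x y = ((x + p) ≡ᵇ y) ∨ ((y + p) ≡ᵇ x)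

    pick-adj : ∀ s t → adj G (pick s) (pick t) ≡ joined? (value s) (value t)
    pick-adj (inj₁ i) (inj₁ j) = trans lhs (≡-sym (∨-false⁺ (far (toℕ i) j) (far (toℕ j) i)))
      where
      lhs : adj G (a i) (a j) ≡ false
      lhs with i ≟ j
      ... | yes refl = irrefl G (a i)
      ... | no h     = aa i j h
    pick-adj (inj₂ i) (inj₂ j) = trans lhs (≡-sym (∨-false⁺ (beyond i j) (beyond j i)))
      where
      lhs : adj G (b i) (b j) ≡ false
      lhs with i ≟ j
      ... | yes refl = irrefl G (b i)
      ... | no h     = bb i j h
    pick-adj (inj₁ i) (inj₂ j) with i ≟ j
    ... | yes refl = trans (edge i) (≡-sym (cong (_∨ ((p + toℕ i + p) ≡ᵇ toℕ i)) (trans (cong (_≡ᵇ (p + toℕ i)) (+-comm (toℕ i) p)) (≡ᵇ-refl (p + toℕ i)))))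
    ... | no h     = trans (ab i j h) (≡-sym (∨-false⁺ (across i j h) (far (p + toℕ j) i)))
    pick-adj (inj₂ i) (inj₁ j) with i ≟ j
    ... | yes refl = trans (adj-swap G (edge i)) (≡-sym (trans (cong (_∨ ((toℕ i + p) ≡ᵇ (p + toℕ i))) (far (p + toℕ i) i))
                       (trans (cong (_≡ᵇ (p + toℕ i)) (+-comm (toℕ i) p)) (≡ᵇ-refl (p + toℕ i)))))
    ... | no h     = trans (adj-swap G (ab j i (λ e → h (≡-sym e)))) (≡-sym (∨-false⁺ (far (p + toℕ i) j) (across j i (λ e → h (≡-sym e)))))

    preserves : ∀ i j → adj G (φ i) (φ j) ≡ adj (pK2 q) i j
    preserves i j = trans (pick-adj (splitAt p i) (splitAt p j))
      (cong₂ joined? (≡-sym (toℕ-value i)) (≡-sym (toℕ-value j)))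

  induced-butterfly : Fin n → (x y u v : Fin n) → Fin 5 → Fin n
  induced-butterfly k x y u v zero = k
  induced-butterfly k x y u v (suc zero) = x
  induced-butterfly k x y u v (suc (suc zero)) = y
  induced-butterfly k x y u v (suc (suc (suc zero))) = u
  induced-butterfly k x y u v (suc (suc (suc (suc zero)))) = v

  no-butterfly : Free butterfly G → ∀ k x y u v →
    adj G k x ≡ true → adj G k y ≡ true → adj G k u ≡ true → adj G k v ≡ true →
    adj G x y ≡ true → adj G u v ≡ true →
    adj G x u ≡ false → adj G x v ≡ false → adj G y u ≡ false → adj G y v ≡ false → ⊥
  no-butterfly free k x y u v kx ky ku kv xy uv xu xv yu yv = free (φ , injective , preserves)
    where
    φ = induced-butterfly k x y u v
    ↔ : ∀ {x y b} → adj G x y ≡ b → adj G y x ≡ b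
    ↔ = adj-swap G
    pattern 0F = zero
    pattern 1F = suc zero
    pattern 2F = suc (suc zero)
    pattern 3F = suc (suc (suc zero))
    pattern 4F = suc (suc (suc (suc zero)))
    preserves : ∀ i j → adj G (φ i) (φ j) ≡ adj butterfly i j
    preserves 0F 0F = irrefl G k
    preserves 0F 1F = kx
    preserves 0F 2F = ky
    preserves 0F 3F = ku
    preserves 0F 4F = kv
    preserves 1F 0F = ↔ kx
    preserves 1F 1F = irrefl G x
    preserves 1F 2F = xy
    preserves 1F 3F = xu
    preserves 1F 4F = xv
    preserves 2F 0F = ↔ ky
    preserves 2F 1F = ↔ xy
    preserves 2F 2F = irrefl G y
    preserves 2F 3F = yu
    preserves 2F 4F = yv
    preserves 3F 0F = ↔ ku
    preserves 3F 1F = ↔ xu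
    preserves 3F 2F = ↔ yu
    preserves 3F 3F = irrefl G u
    preserves 3F 4F = uv
    preserves 4F 0F = ↔ kv
    preserves 4F 1F = ↔ xv
    preserves 4F 2F = ↔ yv
    preserves 4F 3F = ↔ uv
    preserves 4F 4F = irrefl G v
    -- No two vertices of the butterfly have the same neighbours, so a map that preserves and
    -- reflects adjacency cannot identify any.
    twin-free : ∀ i j → (∀ k → adj butterfly i k ≡ adj butterfly j k) → i ≡ j
    twin-free = from-yes (all? λ i → all? λ j → (all? λ k → adj butterfly i k ≟ᵇ adj butterfly j k) →-dec (i ≟ j))
    injective : ∀ {i j} → φ i ≡ φ j → i ≡ j
    injective {i} {j} e = twin-free i j λ k →
      trans (≡-sym (preserves i k)) (trans (cong (λ z → adj G z (φ k)) e) (preserves j k))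

  CliqueSeq : ℕ → (ℕ → Fin n) → Set
  CliqueSeq m ψ = ∀ i j → i < j → j < m → adj G (ψ i) (ψ j) ≡ true

  -- Sequences are total on `ℕ` to keep bounds out of the indices; `d` merely fills the places from
  -- `m` on.
  clique-seq : ∀ m {ω} → Fin n → Clique G m ω →
    Σ (ℕ → Fin n) λ ψ → (∀ i → i < m → ω (ψ i) ≡ true) × CliqueSeq m ψ
  clique-seq zero    d c = (λ _ → d) , (λ _ ()) , λ _ _ _ ()
  clique-seq (suc m) {ω} d (a , ωa , c) with clique-seq m d c
  ... | ψ , ins , adjs = ψ′ , ins′ , adjs′
    where
    ψ′ : ℕ → Fin n
    ψ′ zero    = a
    ψ′ (suc i) = ψ i
    ins′ : ∀ i → i < suc m → ω (ψ′ i) ≡ true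
    ins′ zero    _       = ωa
    ins′ (suc i) (s≤s h) = proj₁ (∧-true (ins i h))
    adjs′ : CliqueSeq (suc m) ψ′
    adjs′ zero    (suc j) _       (s≤s h) = proj₂ (∧-true (ins j h))
    adjs′ (suc i) (suc j) (s≤s l) (s≤s h) = adjs i j l h

  seq-clique : ∀ m {ω} ψ → (∀ i → i < m → ω (ψ i) ≡ true) → CliqueSeq m ψ → Clique G m ω
  seq-clique zero    ψ ins adjs = tt
  seq-clique (suc m) ψ ins adjs = ψ 0 , ins 0 z<s ,
    seq-clique m (λ i → ψ (suc i)) (λ i h → ∧-intro (ins (suc i) (s≤s h)) (adjs 0 (suc i) z<s (s≤s h)))
      (λ i j l h → adjs (suc i) (suc j) (s≤s l) (s≤s h))

  seq-adjacent : ∀ {m ψ} → CliqueSeq m ψ → ∀ {i j} → i < m → j < m → i ≢ j → adj G (ψ i) (ψ j) ≡ true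
  seq-adjacent cl {i} {j} hi hj ne with <-cmp i j
  ... | tri< l _ _ = cl i j l hj
  ... | tri≈ _ e _ = ⊥-elim (ne e)
  ... | tri> _ _ l = adj-swap G (cl j i l hi)

  clique⇒HasClique : ∀ m → Fin n → Clique G m (everything G) → HasClique G m
  clique⇒HasClique m d c with clique-seq m d c
  ... | ψ , _ , cl = (λ i → ψ (toℕ i)) , injective , λ i j → pairwise i j
    where
    distinct : ∀ (i j : Fin m) → i ≢ j → adj G (ψ (toℕ i)) (ψ (toℕ j)) ≡ true
    distinct i j h = seq-adjacent cl (toℕ<n i) (toℕ<n j) λ e → h (toℕ-injective e)
    injective : ∀ {i j : Fin m} → ψ (toℕ i) ≡ ψ (toℕ j) → i ≡ j
    injective {i} {j} e with i ≟ j
    ... | yes h = h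
    ... | no h  = true≢false (distinct i j h) (subst (λ z → adj G z (ψ (toℕ j)) ≡ false) (≡-sym e) (irrefl G _))
    pairwise : ∀ i j → i ≡ j ⊎ Adj G (ψ (toℕ i)) (ψ (toℕ j))
    pairwise i j with i ≟ j
    ... | yes h = inj₁ h
    ... | no h  = inj₂ (distinct i j h)

-- Restriction to a vertex set, the other vertices becoming isolated

  restrict : (Fin n → Bool) → Graph n
  restrict S = record
    { adj    = λ u v → adj G u v ∧ (S u ∧ S v)
    ; sym    = λ u v → cong₂ _∧_ (Graph.sym G u v) (∧-comm (S u) (S v))
    ; irrefl = λ v → cong (_∧ (S v ∧ S v)) (irrefl G v) }

  module _ (S : Fin n → Bool) where

    restrict-adj : ∀ {u v} → adj (restrict S) u v ≡ true → adj G u v ≡ true × S u ≡ true × S v ≡ true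
    restrict-adj {u} {v} e with ∧-true {adj G u v} e
    ... | uv , s with ∧-true {S u} s
    ...   | su , sv = uv , su , sv

    restrict-agrees : ∀ {u v} → S u ≡ true → S v ≡ true → adj (restrict S) u v ≡ adj G u v
    restrict-agrees {u} {v} su sv rewrite su | sv with adj G u v
    ... | true  = refl
    ... | false = refl

    -- Both ends of an edge of the restriction lie in `S`, where the two adjacencies agree; hence
    -- the whole matching stays in `S`.
    restrict-matching : ∀ p {ω} → Matching (restrict S) p ω → Matching G p (λ v → ω v ∧ S v)
    restrict-matching zero    m = tt
    restrict-matching (suc p) {ω} (a , b , (ωa , ωb , e) , m) with restrict-adj e
    ... | ab , sa , sb = a , b , (∧-intro ωa sa , ∧-intro ωb sb , ab) ,
                         Matching-mono G p shrink (restrict-matching p m)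
      where
      shrink : ∀ v → ((ω v ∧ not (adj (restrict S) a v)) ∧ not (adj (restrict S) b v)) ∧ S v ≡ true →
               ((ω v ∧ S v) ∧ not (adj G a v)) ∧ not (adj G b v) ≡ true
      shrink v h with ∧-true {_} {S v} h
      ... | h₁ , sv with ∧-true {_} {not (adj (restrict S) b v)} h₁
      ...   | h₂ , nb with ∧-true {ω v} h₂
      ...     | ωv , na = ∧-intro (∧-intro (∧-intro ωv sv)
                  (subst (λ z → not z ≡ true) (restrict-agrees sa sv) na))
                  (subst (λ z → not z ≡ true) (restrict-agrees sb sv) nb)

    restrict-clique : ∀ k {ω} → Clique (restrict S) k ω → Clique G k ω
    restrict-clique zero    c = tt
    restrict-clique (suc k) {ω} (a , ωa , c) = a , ωa , Clique-mono G k shrink (restrict-clique k c)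
      where
      shrink : ∀ v → ω v ∧ adj (restrict S) a v ≡ true → ω v ∧ adj G a v ≡ true
      shrink v h with ∧-true {ω v} h
      ... | ωv , av = ∧-intro ωv (proj₁ (restrict-adj av))

    -- The butterfly has no isolated vertex, so each of its vertices lands in S.
    restrict-butterfly : Free butterfly G → Free butterfly (restrict S)
    restrict-butterfly free (φ , inj , pres) = free (φ , inj , λ i j →
      trans (≡-sym (restrict-agrees (inside i) (inside j))) (pres i j))
      where
      neighbour : ∀ i → ∃ λ j → adj butterfly i j ≡ true
      neighbour = from-yes (all? λ i → any? λ j → adj butterfly i j ≟ᵇ true)
      inside : ∀ i → S (φ i) ≡ true
      inside i with neighbour i
      ... | j , e = proj₁ (proj₂ (restrict-adj (trans (pres i j) e)))

-- Triangular numbers and pair codes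

tri : ℕ → ℕ
tri zero    = 0
tri (suc j) = j + tri j

tri≡C : ∀ m → tri m ≡ m C 2
tri≡C zero    = refl
tri≡C (suc m) = trans (cong₂ _+_ (≡-sym (nC1≡n m)) (tri≡C m)) (nCk+nC[k+1]≡[n+1]C[k+1] m 1)

tri-mono : ∀ {i j} → i ≤ j → tri i ≤ tri j
tri-mono z≤n     = z≤n
tri-mono (s≤s h) = +-mono-≤ h (tri-mono h)

-- The colexicographic rank of a pair i < j, as `tri j` is the number of pairs below j. The pair (0
-- , 1) has rank 0, and the pairs with j ≤ m have ranks below `tri (suc m)`.
code : ℕ → ℕ → ℕ
code i j = i + tri j

code-bound : ∀ {i j k} → i < j → j < k → code i j < tri k
code-bound {i} {j} i<j j<k = <-≤-trans (+-monoˡ-< (tri j) i<j) (tri-mono j<k)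

code-injective : ∀ {i j i′ j′} → i < j → i′ < j′ → code i j ≡ code i′ j′ → i ≡ i′ × j ≡ j′
code-injective {i} {j} {i′} {j′} h h′ e with <-cmp j j′
... | tri< l _ _ = ⊥-elim (<-irrefl e (<-≤-trans (code-bound h l) (m≤n+m (tri j′) i′)))
... | tri> _ _ l = ⊥-elim (<-irrefl (≡-sym e) (<-≤-trans (code-bound h′ l) (m≤n+m (tri j) i)))
... | tri≈ _ refl _ = +-cancelʳ-≡ (tri j) i i′ e , refl

least : ∀ (P : ℕ → Bool) m →
  (∀ k → k < m → P k ≡ false) ⊎ (∃ λ i → i < m × P i ≡ true × (∀ k → k < i → P k ≡ false))
least P zero    = inj₁ λ _ ()
least P (suc m) with least P m
... | inj₂ (i , i<m , pi , below) = inj₂ (i , m<n⇒m<1+n i<m , pi , below)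
... | inj₁ none with true-or-false (P m)
...   | inj₁ pm = inj₂ (m , n<1+n m , pm , none)
...   | inj₂ pm = inj₁ λ k k<1+m → case-last k (m≤n⇒m<n∨m≡n (s≤s⁻¹ k<1+m))
  where
  case-last : ∀ k → k < m ⊎ k ≡ m → P k ≡ false
  case-last k (inj₁ k<m)  = none k k<m
  case-last k (inj₂ refl) = pm

-- The first two elements i < j of P below m, where j = m if there is only one.
record FirstTwo (P : ℕ → Bool) (m : ℕ) : Set where
  field
    i j    : ℕ
    i<j    : i < j
    j≤m    : j ≤ m
    Pi     : P i ≡ true
    Pj     : j < m → P j ≡ true
    others : ∀ k → k < j → k ≢ i → P k ≡ false

firstTwo : ∀ P m i → i < m → P i ≡ true → (∀ k → k < i → P k ≡ false) → FirstTwo P m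
firstTwo P m i i<m pi below with least (λ k → P (k + suc i)) (m ∸ suc i)
... | inj₁ none = record { i = i ; j = m ; i<j = i<m ; j≤m = ≤-refl ; Pi = pi ; Pj = λ h → ⊥-elim (<-irrefl refl h) ; others = others }
  where
  others : ∀ k → k < m → k ≢ i → P k ≡ false
  others k k<m ne with <-cmp k i
  ... | tri< l _ _ = below k l
  ... | tri≈ _ e _ = ⊥-elim (ne e)
  ... | tri> _ _ l = subst (λ z → P z ≡ false) (m∸n+n≡m l) (none (k ∸ suc i) (∸-monoˡ-< k<m l))
... | inj₂ (d , d<m , pd , belowd) = record
  { i = i ; j = d + suc i ; i<j = m≤n+m (suc i) d
  ; j≤m = ≤-trans (+-monoˡ-≤ (suc i) (<⇒≤ d<m)) (≤-reflexive (m∸n+n≡m i<m)) ; Pi = pi ; Pj = λ _ → pd ; others = others }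
  where
  others : ∀ k → k < d + suc i → k ≢ i → P k ≡ false
  others k k<j ne with <-cmp k i
  ... | tri< l _ _ = below k l
  ... | tri≈ _ e _ = ⊥-elim (ne e)
  ... | tri> _ _ l = subst (λ z → P z ≡ false) (m∸n+n≡m l)
          (belowd (k ∸ suc i) (subst (k ∸ suc i <_) (m+n∸n≡m d (suc i)) (∸-monoˡ-< k<j l)))

Colourable-≤ : ∀ {n} {G : Graph n} {a b} → a ≤ b → Colourable G a → Colourable G b
Colourable-≤ h (c , pc) = (λ v → inject≤ (c v) h) , λ u v uv e →
  pc u v uv (toℕ-injective (trans (≡-sym (toℕ-inject≤ (c u) h)) (trans (cong toℕ e) (toℕ-inject≤ (c v) h))))

-- Colour a vertex outside a maximum clique by its first two non-neighbours i < j in it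
-- (j = m if there is only one).  Adjacent vertices with equal codes would extend the clique
-- if j = m, and otherwise form a butterfly centred at a clique vertex k < j, k ≠ i, which
-- exists unless (i , j) = (0 , 1).
module CliqueStep {n} (G : Graph n) (free : Free butterfly G) (m : ℕ) (2≤m : 2 ≤ m)
  (ψ : ℕ → Fin n) (cl : CliqueSeq G m ψ) (noC : Clique G (suc m) (everything G) → ⊥) where

  missing : Fin n → ℕ → Bool
  missing v k = not (adj G v (ψ k))

  base : Fin n → Bool
  base v = not (adj G (ψ 0) v) ∧ not (adj G (ψ 1) v)

  prepend : Fin n → (ℕ → Fin n) → ℕ → Fin n
  prepend v χ zero    = v
  prepend v χ (suc k) = χ k

  no-extension : ∀ v χ → CliqueSeq G m χ → (∀ k → k < m → adj G v (χ k) ≡ true) → ⊥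
  no-extension v χ clχ h = noC (seq-clique G (suc m) (prepend v χ) (λ _ _ → refl) clique′)
    where
    clique′ : CliqueSeq G (suc m) (prepend v χ)
    clique′ zero    (suc j) _       (s≤s l) = h j l
    clique′ (suc i) (suc j) (s≤s k) (s≤s l) = clχ i j k l

  -- A vertex seeing the whole clique would enlarge it, so some index is missed. The clique vertices
  -- need no special treatment: `ψ k` misses just itself and receives the pair (k , m).
  place : ∀ v → FirstTwo (missing v) m
  place v with least (missing v) m
  ... | inj₁ none = ⊥-elim (no-extension v ψ cl λ k h → affirm λ e → true≢false (not-intro e) (none k h))
  ... | inj₂ (i , i<m , pi , below) = firstTwo (missing v) m i i<m pi below

  module P v = FirstTwo (place v)

  key : Fin n → ℕ
  key v = code (P.i v) (P.j v)

  sees : ∀ v k → k < P.j v → k ≢ P.i v → adj G v (ψ k) ≡ true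
  sees v k h ne = affirm λ e → true≢false (not-intro e) (P.others v k h ne)

  -- For j = m: u sees the clique except `ψ i`, so exchanging `ψ i` for u leaves a clique, and v,
  -- which has the same pair and is adjacent to u, extends it.
  substitute : ℕ → Fin n → ℕ → Fin n
  substitute i u k with k ≟ⁿ i
  ... | yes _ = u
  ... | no _  = ψ k

  substitute-clique : ∀ i u → (∀ k → k < m → k ≢ i → adj G u (ψ k) ≡ true) → CliqueSeq G m (substitute i u)
  substitute-clique i u h k l k<l l<m with k ≟ⁿ i | l ≟ⁿ i
  ... | yes refl | yes refl = ⊥-elim (<-irrefl refl k<l)
  ... | yes refl | no ne    = h l l<m ne
  ... | no ne    | yes refl = adj-swap G (h k (<-≤-trans k<l (<⇒≤ l<m)) ne)
  ... | no _     | no _     = cl k l k<l l<m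

  outside-code-zero : ∀ u v → adj G u v ≡ true → P.i u ≡ P.i v → P.j u ≡ P.j v →
    ∀ k → k < P.j u → k ≢ P.i u → ⊥
  outside-code-zero u v uv ei ej k k<j ne with m≤n⇒m<n∨m≡n (P.j≤m u)
  ... | inj₂ j≡m = no-extension v (substitute (P.i u) u) (substitute-clique (P.i u) u seesu) adjacent
    where
    seesu : ∀ l → l < m → l ≢ P.i u → adj G u (ψ l) ≡ true
    seesu l h = sees u l (subst (l <_) (≡-sym j≡m) h)
    adjacent : ∀ l → l < m → adj G v (substitute (P.i u) u l) ≡ true
    adjacent l h with l ≟ⁿ P.i u
    ... | yes _ = adj-swap G uv
    ... | no nl = sees v l (subst (l <_) (trans (≡-sym j≡m) ej) h) (λ e → nl (trans e (≡-sym ei)))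
  -- The two triangles are `ψ k`, `ψ i`, `ψ j` and `ψ k`, u, v.
  ... | inj₁ j<m = no-butterfly G free (ψ k) (ψ (P.i u)) (ψ (P.j u)) u v
      (seq-adjacent G cl k<m i<m ne) (cl k (P.j u) k<j j<m)
      (adj-swap G (sees u k k<j ne))
      (adj-swap G (sees v k (subst (k <_) ej k<j) (λ e → ne (trans e (≡-sym ei)))))
      (cl (P.i u) (P.j u) (P.i<j u) j<m) uv
      (adj-swap G (not-true (P.Pi u)))
      (adj-swap G (not-true (subst (λ z → missing v z ≡ true) (≡-sym ei) (P.Pi v))))
      (adj-swap G (not-true (P.Pj u j<m)))
      (adj-swap G (not-true (subst (λ z → missing v z ≡ true) (≡-sym ej) (P.Pj v (subst (_< m) ej j<m)))))
    where
    k<m = <-≤-trans k<j (P.j≤m u)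
    i<m = <-≤-trans (P.i<j u) (P.j≤m u)

  same-key : ∀ u v → adj G u v ≡ true → key u ≡ key v → P.i u ≡ 0 × P.j u ≡ 1
  same-key u v uv e with code-injective (P.i<j u) (P.i<j v) e
  ... | ei , ej with P.i u ≟ⁿ 0 | P.j u ≟ⁿ 1
  ...   | yes i0 | yes j1 = i0 , j1
  -- The index 0 lies below j and differs from i; if i = 0, the index 1 does the same unless j = 1.
  ...   | no i≢0 | _ = ⊥-elim (outside-code-zero u v uv ei ej 0 (≤-<-trans z≤n (P.i<j u)) (λ z → i≢0 (≡-sym z)))
  ...   | yes i0 | no j≢1 = ⊥-elim (outside-code-zero u v uv ei ej 1 (two (P.j u) (subst (_< P.j u) i0 (P.i<j u)) j≢1)
                                      (λ z → case-⊥ (trans z i0)))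
    where
    two : ∀ j → 0 < j → j ≢ 1 → 1 < j
    two (suc zero)    _ h = ⊥-elim (h refl)
    two (suc (suc j)) _ _ = s≤s z<s
    case-⊥ : 1 ≡ 0 → ⊥
    case-⊥ ()

  key-zero : ∀ v → key v ≡ 0 → P.i v ≡ 0 × P.j v ≡ 1
  key-zero v e = code-injective (P.i<j v) z<s e

  -- By `2 ≤ m` the index 1 is not the default m, so j = 1 is a true non-neighbour.
  base-member : ∀ v → P.i v ≡ 0 → P.j v ≡ 1 → base v ≡ true
  base-member v i0 j1 = ∧-intro
    (not-intro (adj-swap G (not-true (subst (λ z → missing v z ≡ true) i0 (P.Pi v)))))
    (not-intro (adj-swap G (not-true (subst (λ z → missing v z ≡ true) j1 (P.Pj v (subst (_< m) (≡-sym j1) 2≤m))))))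

  -- Key 0 is spread over the `k` colours of the restriction, and every other key below
  -- `tri (suc m)` gets one new colour.
  step : ∀ k → Colourable (restrict G base) k → Colourable G (k + pred (tri (suc m)))
  step k (c , pc) = (λ v → fromℕ< (bounded v)) , λ u v uv e →
    proper u v uv (trans (≡-sym (toℕ-fromℕ< (bounded u))) (trans (cong toℕ e) (toℕ-fromℕ< (bounded v))))
    where
    colour′ : Fin n → ℕ → ℕ
    colour′ v zero    = toℕ (c v)
    colour′ v (suc x) = k + x

    key<tri : ∀ v → key v < tri (suc m)
    key<tri v = code-bound (P.i<j v) (s≤s (P.j≤m v))

    bounded′ : ∀ v x → x < tri (suc m) → colour′ v x < k + pred (tri (suc m))
    bounded′ v zero    h = <-≤-trans (toℕ<n (c v)) (m≤m+n k _)
    bounded′ v (suc x) h = +-monoʳ-< k (pred-mono-≤ h)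

    bounded : ∀ v → colour′ v (key v) < k + pred (tri (suc m))
    bounded v = bounded′ v (key v) (key<tri v)

    proper : ∀ u v → adj G u v ≡ true → colour′ u (key u) ≡ colour′ v (key v) → ⊥
    proper u v uv e with key u in eu | key v in ev
    ... | zero  | suc x = <⇒≱ (toℕ<n (c u)) (subst (k ≤_) (≡-sym e) (m≤m+n k x))
    ... | suc x | zero  = <⇒≱ (toℕ<n (c v)) (subst (k ≤_) e (m≤m+n k x))
    ... | suc x | suc y with same-key u v uv (trans eu (trans (cong suc (+-cancelˡ-≡ k x y e)) (≡-sym ev)))
    ...   | i0 , j1 with () ← trans (≡-sym eu) (cong₂ code i0 j1)
    proper u v uv e | zero | zero = pc u v
      (trans (restrict-agrees G base (member u eu) (member v ev)) uv) (toℕ-injective e)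
      where
      member : ∀ w → key w ≡ 0 → base w ≡ true
      member w h = base-member w (proj₁ (key-zero w h)) (proj₂ (key-zero w h))

-- The bounding function

C2-mono : ∀ m → suc m C 2 ≤ suc (suc m) C 2
C2-mono m = subst₂ _≤_ (tri≡C (suc m)) (tri≡C (suc (suc m))) (tri-mono (n≤1+n (suc m)))

-- At m = 2 the bound is a closed formula and from m = 3 on a recursion in p; this compares the two
-- for `f-mono`.
f-three : ∀ q → 4 + 2 * q ≤ f (2 + q) 3
f-three zero    = ≤-refl
f-three (suc q) = subst₂ _≤_ (cong (4 +_) (≡-sym (*-suc 2 q))) (≡-sym (+-∸-assoc (f (2 + q) 3) {6} {1} (s≤s z≤n)))
  (≤-trans (≤-reflexive (rearrange q)) (+-mono-≤ (f-three q) (s≤s (s≤s (z≤n {3})))))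
  where
  rearrange : ∀ q → 4 + (2 + 2 * q) ≡ (4 + 2 * q) + 2
  rearrange q = cong (4 +_) (+-comm 2 (2 * q))

f-mono : ∀ q w → f (2 + q) (suc w) ≤ f (2 + q) (suc (suc w))
f-mono zero zero                = s≤s z≤n
f-mono zero (suc zero)          = s≤s (s≤s (s≤s z≤n))
f-mono zero (suc (suc zero))    = s≤s (s≤s (s≤s (s≤s z≤n)))
f-mono zero (suc (suc (suc w))) = C2-mono (suc (suc (suc (suc w))))
f-mono (suc q) zero             = ≤-trans (s≤s z≤n) (≤-reflexive (≡-sym (cong (_∸ 2) (trans (*-suc 2 (2 + q)) (cong (2 +_) (*-suc 2 (1 + q)))))))
f-mono (suc q) (suc zero)       = ≤-trans
  (≤-reflexive (cong (_∸ 2) (trans (*-suc 2 (2 + q)) (cong (2 +_) (trans (*-suc 2 (1 + q)) (cong (2 +_) (*-suc 2 q)))))))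
  (≤-trans (f-three q) (≤-trans (m≤m+n (f (2 + q) 3) 5) (≤-reflexive (≡-sym (+-∸-assoc (f (2 + q) 3) {6} {1} (s≤s z≤n))))))
f-mono (suc q) (suc (suc w))    = ∸-monoˡ-≤ 1 (+-mono-≤ (f-mono q (suc (suc w))) (C2-mono (suc (suc (suc w)))))

pred-bound : ∀ k w → k + pred (tri (suc (suc w))) ≡ (k + suc (suc w) C 2) ∸ 1
pred-bound k w = trans (≡-sym (+-∸-assoc k {tri (suc (suc w))} {1} (s≤s z≤n)))
                       (cong (λ z → (k + z) ∸ 1) (tri≡C (suc (suc w))))

-- The induction on p and ω

module _ {n} (G : Graph n) where
  open Partial G

  restrict-no-matching : ∀ p a b → adj G a b ≡ true → (Matching G (suc p) (everything G) → ⊥) →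
    Matching (restrict G (λ v → not (adj G a v) ∧ not (adj G b v))) p (everything G) → ⊥
  restrict-no-matching p a b ab noM m = noM (a , b , (refl , refl , ab) , restrict-matching G _ p m)

  by-clique : Free butterfly G → ∀ p w → (Matching G (suc p) (everything G) → ⊥) →
    (Clique G (3 + w) (everything G) → ⊥) → Clique G (2 + w) (everything G) →
    ∀ k → (∀ H → (Matching {n} H p (everything H) → ⊥) → Free butterfly H → (Clique H (3 + w) (everything H) → ⊥) → Colourable H k) →
    Colourable G ((k + (3 + w) C 2) ∸ 1)
  by-clique free p w noM noC c k rec with clique-seq G (2 + w) (proj₁ c) c
  ... | ψ , _ , cl = subst (Colourable G) (pred-bound k (suc w))
      (step k (rec (restrict G base) (restrict-no-matching p (ψ 0) (ψ 1) (cl 0 1 z<s (s≤s z<s)) noM)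
                   (restrict-butterfly G base free) (λ d → noC (restrict-clique G base (3 + w) d))))
    where open CliqueStep G free (2 + w) (s≤s (s≤s z≤n)) ψ cl noC

-- The restriction to `base` may have a smaller clique number, so the induction hypothesis only
-- bounds cliques from above; `CliqueBound` adds that the bound is attained.
Bound : ℕ → ℕ → ℕ → Set
Bound p w k = ∀ {n} (G : Graph n) → (Matching G p (everything G) → ⊥) → Free butterfly G →
  (Clique G (suc w) (everything G) → ⊥) → Colourable G k

CliqueBound : ℕ → ℕ → ℕ → Set
CliqueBound p w k = ∀ {n} (G : Graph n) → (Matching G p (everything G) → ⊥) → Free butterfly G →
  (Clique G (suc w) (everything G) → ⊥) → Clique G w (everything G) → Colourable G k

-- This serves as the bound for p = 1 in place of `f 1`, which takes junk values.
edgeless : ∀ w → Bound 1 w 1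
edgeless w G noM free noC = (λ _ → zero) , λ u v uv _ → noM (u , v , (refl , refl , uv) , tt)

clique-bound₂ : ∀ w → CliqueBound 2 (2 + w) (f 2 (2 + w))
clique-bound₂ zero          G noM free noC c = by-clique G free 1 0 noM noC c 1 (edgeless 2)
clique-bound₂ (suc zero)    G noM free noC c = Without2K₂K₄.four-colourable G noM noC
clique-bound₂ (suc (suc w)) G noM free noC c = by-clique G free 1 (2 + w) noM noC c 1 (edgeless (4 + w))

clique-bound : ∀ q w → Bound (2 + q) (2 + w) (f (2 + q) (2 + w)) → CliqueBound (3 + q) (2 + w) (f (3 + q) (2 + w))
clique-bound zero    zero    rec G noM free noC c = Without3K₂K₃.four-colourable G noM noC
clique-bound (suc q) zero    rec G noM free noC c =
  subst (Colourable G) (two-more q) (by-clique G free (3 + q) 0 noM noC c (f (3 + q) 2) rec)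
  where
  two-more : ∀ q → ((2 * (3 + q) ∸ 2) + 3) ∸ 1 ≡ 2 * (4 + q) ∸ 2
  two-more q = trans (cong (λ z → ((z ∸ 2) + 3) ∸ 1) (*-suc 2 (2 + q)))
    (trans (+-∸-assoc (2 * (2 + q)) {3} {1} (s≤s z≤n))
    (trans (+-comm (2 * (2 + q)) 2)
    (≡-sym (cong (_∸ 2) (trans (*-suc 2 (3 + q)) (cong (2 +_) (*-suc 2 (2 + q))))))))
clique-bound q (suc w) rec G noM free noC c = by-clique G free (2 + q) (suc w) noM noC c (f (2 + q) (3 + w)) rec

-- Without a clique of the full size the bound for the next smaller size applies, and monotonicity
-- of `f` makes it good enough.
descend : ∀ q w → Bound (2 + q) (suc w) (f (2 + q) (suc w)) → CliqueBound (2 + q) (2 + w) (f (2 + q) (2 + w)) →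
  Bound (2 + q) (2 + w) (f (2 + q) (2 + w))
descend q w rec bound G noM free noC with Partial.Clique? G (2 + w) (everything G)
... | yes c   = bound G noM free noC c
... | no none = Colourable-≤ {G = G} (f-mono q w) (rec G noM free none)

bounded : ∀ q w → Bound (2 + q) w (f (2 + q) w)
-- Without a clique of size 1 there is no vertex, which matches the value 0 of `f` at 0.
bounded q zero G noM free noC = (λ v → ⊥-elim (noC (v , refl , tt))) , λ u → ⊥-elim (noC (u , refl , tt))
bounded q (suc zero) G noM free noC = (λ _ → zero) , λ u v uv _ → noC (u , refl , v , uv , tt)
bounded zero    (suc (suc w)) = descend zero w (bounded zero (suc w)) (clique-bound₂ w)
bounded (suc q) (suc (suc w)) = descend (suc q) w (bounded (suc q) (suc w)) (clique-bound q w (bounded q (suc (suc w))))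

theorem3p8 : (p : ℕ) → 2 ≤ p → (n : ℕ) → (G : Graph n) →
    Free (pK2 (Data.Nat.pred p)) G → Free butterfly G →
    (w : ℕ) → IsCliqueNumber G w → Colourable G (f p w)
theorem3p8 (suc (suc q)) (s≤s (s≤s z≤n)) n G noK free w (_ , maximal) =
  bounded q w G (λ m → noK (matching⇒induced G (suc q) m)) free
    (λ c → <-irrefl refl (maximal (suc w) (clique⇒HasClique G (suc w) (proj₁ c) c)))
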